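{- Let $m\ge 1$ be an integer and $0<\varepsilon\le 1$. For the problem $P_m|\varepsilon,\mathrm{online},pmtn|\sum p_j(1-U_j)$ (online maximization of total accepted processing time on $m$ parallel identical machines, with preemption and migration, commitment on acceptance, and slack factor $\varepsilon$), the strict competitive ratio of any deterministic online algorithm is at least $$\frac{\lfloor m(1+\varepsilon)\rfloor}{\varepsilon\cdot\sum_{i=0}^{m-1}\left(\frac{1+\varepsilon}{\varepsilon}\right)^{\frac im}}=\lfloor m(1+\varepsilon)\rfloor\cdot\left(\left(\frac{1+\varepsilon}{\varepsilon}\right)^{\frac1m}-1\right).$$
   Context: Problem. There are $m$ parallel identical machines and a finite sequence $\mathcal{J}$ of jobs. Job $J_j$ has release (submission) date $r_j\ge 0$, processing time $p_j>0$ and deadline $d_j$ satisfying the slack condition $d_j-r_j\ge(1+\varepsilon)p_j$. The sequence is ordered so that $J_i$ precedes $J_j$ whenever $r_i<r_j$ (several jobs may have the same release date). Jobs are revealed in sequence order; job $J_j$ becomes known at time $r_j$, and the online algorithm must decide immediately, before seeing any later job of the sequence, whether to accept it ($U_j=0$) or reject it ($U_j=1$). The decision is irrevocable, and every accepted job must be processed completely within $[r_j,d_j]$. Preemption: a job in execution may be interrupted at any time and resumed immediately or later, possibly on a different machine, without penalty; at any time a machine processes at most one job and a job is processed on at most one machine. The online algorithm may choose and modify the future schedule of accepted jobs over time, provided all accepted jobs meet their deadlines. The objective is to maximize $\sum_j p_j(1-U_j)$. Let $\mathrm{ALG}(\mathcal{J})$ be the objective value of the online algorithm and $\mathrm{OPT}(\mathcal{J})$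 the optimal offline value, i.e. the maximum total processing time of a subset of the jobs of $\mathcal{J}$ that has a preemptive schedule (with migration) on $m$ machines completing each job of the subset between its release date and its deadline. The algorithm has strict competitive ratio (at most) $c_{ALG}$ if $\mathrm{OPT}(\mathcal{J})\le c_{ALG}\cdot\mathrm{ALG}(\mathcal{J})$ for every job sequence $\mathcal{J}$ satisfying the slack condition; a number $c$ is a lower bound if $c\le c_{ALG}$ for every deterministic online algorithm and every such $c_{ALG}$ for it. -}

module Defs where

open import Algebra.Bundles using (CommutativeRing; Semiring)
import Algebra.Construct.NaturalChoice.Max as Max
import Algebra.Definitions as AlgebraDefinitions
import Algebra.Definitions.RawSemiring as RawSemiringDefinitions
open import Axiom.ExcludedMiddle using (ExcludedMiddle)
open import Data.Bool.Base using (Bool; if_then_else_)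
open import Data.Fin.Base using (Fin; suc)
open import Data.Fin.Properties using (_≟_)
open import Data.Fin.Subset using (Subset; _∈_; inside; outside)
open import Data.List.Base as List using (List)
open import Data.List.Relation.Unary.All as ListAll using ()
open import Data.List.Relation.Unary.AllPairs as ListAllPairs using ()
open import Data.List.Relation.Unary.Any as ListAny using ()
open import Data.Nat.Base as ℕ using (ℕ; zero; suc)
open import Data.Product.Base using (∃; _×_; _,_)
open import Data.Sum.Base using (_⊎_)
open import Data.Vec.Base using (Vec; []; _∷_; lookup)
open import Data.Vec.Relation.Unary.All using (All)
open import Data.Vec.Relation.Unary.AllPairs using (AllPairs)
open import Function.Base using (_∘_)
open import Function.Bundles using (_⇔_)
open import Level using (0ℓ)
open import Relation.Binary.Bundles using (TotalOrder)
open import Relation.Binary.Core using (Rel)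
open import Relation.Binary.PropositionalEquality.Core using (_≡_)
import Relation.Binary.Construct.NonStrictToStrict as NonStrictToStrict
open import Relation.Binary.Structures using (IsTotalOrder)
open import Relation.Nullary.Decidable.Core using (does; yes; no)
open import Relation.Nullary.Negation.Core using (¬_)
open import Relation.Unary using (Pred)

-- The standard library has no real numbers.  Classically, ℝ is the unique
-- model of the following axioms up to isomorphism.
record CompleteOrderedField : Set₁ where
  infix 4 _≤_ _<_
  field
    commutativeRing : CommutativeRing 0ℓ 0ℓ

  open CommutativeRing commutativeRing public
  open AlgebraDefinitions _≈_ using (Invertible)

  field
    0≉1        : ¬ 0# ≈ 1#
    invertible : ∀ x → ¬ x ≈ 0# → Invertible 1# _*_ x

    _≤_          : Rel Carrier 0ℓ
    isTotalOrder : IsTotalOrder _≈_ _≤_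
    +-monoˡ-≤    : ∀ z {x y} → x ≤ y → x + z ≤ y + z
    *-nonNeg     : ∀ {x y} → 0# ≤ x → 0# ≤ y → 0# ≤ x * y

  _<_ : Rel Carrier 0ℓ
  _<_ = NonStrictToStrict._<_ _≈_ _≤_

  IsUpperBound : Pred Carrier 0ℓ → Pred Carrier 0ℓ
  IsUpperBound P b = ∀ x → P x → x ≤ b

  field
    complete : (P : Pred Carrier 0ℓ) → ∃ P → ∃ (IsUpperBound P) →
               ∃ λ s → IsUpperBound P s × (∀ b → IsUpperBound P b → s ≤ b)

  open Semiring semiring public using (rawSemiring)

  totalOrder : TotalOrder 0ℓ 0ℓ 0ℓ
  totalOrder = record { isTotalOrder = isTotalOrder }

  open Max totalOrder public using (_⊔_)
  open RawSemiringDefinitions rawSemiring public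
    using (_^_; sum)
    renaming (_×_ to _·_)

  fromℕ : ℕ → Carrier
  fromℕ n = n · 1#

module Real (em : ExcludedMiddle 0ℓ) (ℝ : CompleteOrderedField) where

  open CompleteOrderedField ℝ

  infix  8 _⁻¹
  infixl 7 _/_
  infixr 8 _^[_/_]

  -- Some element satisfying P if there is one, and the default value
  -- otherwise.  The defaults are never reached where the operations below
  -- have their usual domains.
  choose : {A : Set} → A → Pred A 0ℓ → A
  choose default P with em {∃ P}
  ... | yes (x , _) = x
  ... | no  _       = default

  _⁻¹ : Carrier → Carrier
  x ⁻¹ = choose 0# (λ y → x * y ≈ 1#)

  _/_ : Carrier → Carrier → Carrier
  x / y = x * y ⁻¹

  ⌊_⌋ : Carrier → ℕ
  ⌊ x ⌋ = choose 0 (λ k → fromℕ k ≤ x × x < fromℕ (suc k))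

  root : ℕ → Carrier → Carrier
  root n x = choose 0# (λ y → 0# ≤ y × y ^ n ≈ x)

  -- x to the power i/n
  _^[_/_] : Carrier → ℕ → ℕ → Carrier
  x ^[ i / n ] = root n x ^ i

module Scheduling (em : ExcludedMiddle 0ℓ) (ℝ : CompleteOrderedField)
                  (m : ℕ) (ε : CompleteOrderedField.Carrier ℝ) where

  open CompleteOrderedField ℝ

  record Job : Set where
    field
      release proc deadline : Carrier

  open Job public

  record ValidJob (j : Job) : Set where
    field
      release≥0 : 0# ≤ release j
      proc>0    : 0# < proc j
      slack     : (1# + ε) * proc j ≤ deadline j - release j

  -- Job sequences are stored with the last submitted job at the head, so
  -- that  j ∷ J  extends the history J by the new job j.
  record Valid {n} (J : Vec Job n) : Set where
    field
      jobs    : All ValidJob J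
      ordered : AllPairs (λ j i → release i ≤ release j) J

  -- Machine `machine` processes job `job` throughout [start, stop).
  record Piece (n : ℕ) : Set where
    field
      machine    : Fin m
      job        : Fin n
      start stop : Carrier
      start<stop : start < stop

  open Piece public

  -- A preemptive schedule with migration: the pieces of one job may lie on
  -- different machines.
  Schedule : ℕ → Set
  Schedule n = List (Piece n)

  Running : ∀ {n} → Schedule n → Carrier → Fin m → Fin n → Set
  Running σ t k i =
    ListAny.Any (λ p → machine p ≡ k × job p ≡ i × start p ≤ t × t < stop p) σ

  processed : ∀ {n} → Schedule n → Fin n → Carrier
  processed σ i =
    List.foldr _+_ 0#
      (List.map (λ p → stop p - start p) (List.filter (λ p → job p ≟ i) σ))

  record IsFeasible {n} (J : Vec Job n) (S : Subset n) (σ : Schedule n) : Set where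
    field
      onlyS      : ListAll.All (λ p → job p ∈ S) σ
      inWindow   : ListAll.All (λ p → release (lookup J (job p)) ≤ start p
                                    × stop p ≤ deadline (lookup J (job p))) σ
      noConflict : ListAllPairs.AllPairs
                     (λ p q → machine p ≡ machine q ⊎ job p ≡ job q →
                              stop p ≤ start q ⊎ stop q ≤ start p) σ
      completed  : ∀ i → i ∈ S → processed σ i ≈ proc (lookup J i)

  Feasible : ∀ {n} → Vec Job n → Subset n → Set
  Feasible J S = ∃ (IsFeasible J S)

  volume : ∀ {n} → Vec Job n → Subset n → Carrier
  volume J S = sum (λ i → if lookup S i then proc (lookup J i) else 0#)

  maxOverSubsets : ∀ {n} → (Subset n → Carrier) → Carrier
  maxOverSubsets {zero}  f = f []
  maxOverSubsets {suc n} f =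
    maxOverSubsets (f ∘ (inside ∷_)) ⊔ maxOverSubsets (f ∘ (outside ∷_))

  -- The value 0# given to infeasible subsets does not affect the maximum:
  -- the empty subset is feasible and has volume 0#.
  OPT : ∀ {n} → Vec Job n → Carrier
  OPT J = maxOverSubsets λ S → if does (em {Feasible J S}) then volume J S else 0#

  acceptedBy : (∀ {n} → Vec Job n → Job → Bool) → ∀ {n} → Vec Job n → Subset n
  acceptedBy accept []      = []
  acceptedBy accept (j ∷ J) = accept J j ∷ acceptedBy accept J

  -- `plan J` is the entire schedule carried out if no job follows J.  When a
  -- new job j arrives, only the part of it before release j has been
  -- executed; everything from release j on may be replanned.  Index i of J
  -- becomes suc i in  j ∷ J.
  record OnlineAlgorithm : Set where
    field
      accept : ∀ {n} → Vec Job n → Job → Bool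
      plan   : ∀ {n} → Vec Job n → Schedule n

    accepted : ∀ {n} → Vec Job n → Subset n
    accepted = acceptedBy accept

    field
      plan-feasible : ∀ {n} (J : Vec Job n) → Valid J →
                      IsFeasible J (accepted J) (plan J)
      plan-online   : ∀ {n} (j : Job) (J : Vec Job n) → Valid (j ∷ J) →
                      ∀ t → t < release j → ∀ k i →
                      Running (plan (j ∷ J)) t k (suc i) ⇔ Running (plan J) t k i

  ALG : OnlineAlgorithm → ∀ {n} → Vec Job n → Carrier
  ALG A J = volume J (OnlineAlgorithm.accepted A J)

  HasStrictCompetitiveRatio : OnlineAlgorithm → Carrier → Set
  HasStrictCompetitiveRatio A c =
    ∀ {n} (J : Vec Job n) → Valid J → OPT J ≤ c * ALG A J

module Submission where

-- Let b be the m-th root of (1 + ε) / ε and k = ⌊ m (1 + ε) ⌋, and suppose the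
-- ratio is c < k (b - 1).  Pick g = 1 + s with s < b - 1 and c ≤ k s.  The
-- adversary releases everything at time 0: for i = 0, 1, 2, … it offers up to
-- k copies of a job of length g^i with tight deadline (1 + ε) g^i and goes on
-- to i + 1 as soon as one of them is accepted.  All k copies together can be
-- scheduled, and the volume V = (g^i - 1) / s accepted so far satisfies
-- c V < k g^i, so one copy is always accepted.
--
-- Before D = (1 + ε) g^i an accepted job of length p must receive the work
-- p if p ≤ g^i, and D - ε p if p ≥ g^i.  Adding this up over the lengths
-- g^0, …, g^(i+m-1) and comparing with the capacity m D gives
-- (1 + ε - ε g^m) g^i ≤ 1, which fails for large i because g < b.

open import Defs
import Algebra.Construct.NaturalChoice.Max as Max
import Algebra.Construct.NaturalChoice.Min as Min
open import Algebra.Bundles using (CommutativeRing)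
import Algebra.Properties.AbelianGroup as AbelianGroupProperties
import Algebra.Properties.Ring as RingProperties
import Algebra.Properties.Semiring.Exp as Exp
import Algebra.Properties.Semiring.Mult as Mult
import Algebra.Properties.Semiring.Mult.TCOptimised as OptimisedMult
import Algebra.Properties.Semiring.Sum as Sum
import Algebra.Solver.Ring as RingSolver
open import Algebra.Solver.Ring.AlmostCommutativeRing
  using (fromCommutativeRing; _-Raw-AlmostCommutative⟶_)
open import Axiom.ExcludedMiddle using (ExcludedMiddle)
open import Data.Bool.Base using (true; false; if_then_else_)
open import Data.Empty using (⊥-elim)
open import Data.Fin.Base as Fin using (Fin; zero; suc; toℕ; _↑ˡ_)
import Data.Fin.Properties as Fin
open import Data.Fin.Subset using (Subset; _∈_; inside; outside)
open import Data.Integer.Base as ℤ using (ℤ; +_; -[1+_])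
import Data.Integer.Properties as ℤ
open import Data.List.Base as List using (List; []; _∷_; filter)
import Data.List.Properties as List
open import Data.List.Relation.Unary.All as All using (All; []; _∷_)
import Data.List.Relation.Unary.All.Properties as All
open import Data.List.Relation.Unary.AllPairs using (AllPairs; []; _∷_)
import Data.List.Relation.Unary.AllPairs.Properties as AllPairs
open import Data.Maybe.Base using (Maybe; map)
open import Data.Nat.Base as ℕ using (ℕ; zero; suc; NonZero; z≤n; s≤s)
open import Data.Nat.DivMod using (_%_; %-distribˡ-+; m<n⇒m%n≡m; [m+n]%n≡m%n; m%n<n)
import Data.Nat.Properties as ℕ
open import Data.Product.Base using (∃; _×_; _,_; proj₁; proj₂)
import Data.Sign.Base as Sign
open import Data.Sum.Base using (_⊎_; inj₁; inj₂)
open import Data.Vec.Base as Vec using (Vec; []; _∷_; lookup)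
open import Data.Vec.Properties
  using (lookup⇒[]=; []=⇒lookup; lookup-++ˡ; lookup-++ʳ; lookup-replicate)
open import Data.Vec.Relation.Unary.All as VecAll using ([]; _∷_)
import Data.Vec.Relation.Unary.All.Properties as VecAll
open import Data.Vec.Relation.Unary.AllPairs as VecAllPairs using ([]; _∷_)
open import Function.Base using (_∘_; id)
open import Level using (0ℓ)
open import Relation.Binary.Bundles using (TotalOrder)
open import Relation.Binary.Core using (Rel)
open import Relation.Binary.Definitions using (tri<; tri≈; tri>)
import Relation.Binary.Properties.TotalOrder as TotalOrderProperties
open import Relation.Binary.PropositionalEquality.Core as ≡ using (_≡_; _≢_)
import Relation.Binary.PropositionalEquality.Properties as ≡
import Relation.Binary.Reasoning.PartialOrder as PartialOrderReasoning
import Relation.Binary.Reasoning.Setoid as SetoidReasoning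
open import Relation.Nullary.Decidable using (does; yes; no; dec-true; dec⇒maybe)
open import Relation.Nullary.Negation.Core using (¬_; contradiction)
open import Relation.Unary using (Pred; Decidable)

-- A ring solver with integer coefficients

module IntegerRingSolver {c ℓ} (R : CommutativeRing c ℓ) where

  open CommutativeRing R
  open RingProperties ring
  open AbelianGroupProperties +-abelianGroup using (⁻¹-∙-comm; ⁻¹-involutive; ε⁻¹≈ε)
  open OptimisedMult semiring using (1+×; ×-homo-+; ×1-homo-*) renaming (_×_ to _·_)
  open SetoidReasoning setoid

  -- The optimised multiple is used because it makes the image of 1 the
  -- literal 1#, which the solver needs to recognise constants.
  ⟦_⟧ : ℤ → Carrier
  ⟦ + n ⟧      = n · 1#
  ⟦ -[1+ n ] ⟧ = - (suc n · 1#)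

  neg-homo : ∀ i → ⟦ ℤ.- i ⟧ ≈ - ⟦ i ⟧
  neg-homo (+ zero)  = sym ε⁻¹≈ε
  neg-homo (+ suc n) = refl
  neg-homo -[1+ n ]  = sym (⁻¹-involutive _)

  -- `⊖` lowers both arguments together, so the inductive step only has to insert the cancelling
  -- pair `1# - 1#`.
  ⊖-homo : ∀ m n → ⟦ m ℤ.⊖ n ⟧ ≈ m · 1# - n · 1#
  ⊖-homo m       zero    = sym (trans (+-congˡ ε⁻¹≈ε) (+-identityʳ _))
  ⊖-homo zero    (suc n) = sym (+-identityˡ _)
  ⊖-homo (suc m) (suc n) = begin
    ⟦ suc m ℤ.⊖ suc n ⟧                     ≡⟨ ≡.cong ⟦_⟧ (ℤ.[1+m]⊖[1+n]≡m⊖n m n) ⟩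
    ⟦ m ℤ.⊖ n ⟧                             ≈⟨ ⊖-homo m n ⟩
    m · 1# - n · 1#                         ≈⟨ +-congʳ (+-identityʳ _) ⟨
    m · 1# + 0# - n · 1#                    ≈⟨ +-congʳ (+-congˡ (-‿inverseʳ 1#)) ⟨
    m · 1# + (1# - 1#) - n · 1#             ≈⟨ +-congʳ (+-assoc _ _ _) ⟨
    m · 1# + 1# - 1# - n · 1#               ≈⟨ +-congʳ (+-congʳ (+-comm _ _)) ⟩
    1# + m · 1# - 1# - n · 1#               ≈⟨ +-assoc _ _ _ ⟩
    1# + m · 1# + (- 1# - n · 1#)           ≈⟨ +-congˡ (⁻¹-∙-comm _ _) ⟩
    1# + m · 1# - (1# + n · 1#)             ≈⟨ +-cong (1+× m 1#) (-‿cong (1+× n 1#)) ⟨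
    suc m · 1# - suc n · 1#                 ∎

  +-homo : ∀ i j → ⟦ i ℤ.+ j ⟧ ≈ ⟦ i ⟧ + ⟦ j ⟧
  +-homo (+ m)    (+ n)    = ×-homo-+ 1# m n
  +-homo (+ m)    -[1+ n ] = ⊖-homo m (suc n)
  +-homo -[1+ m ] (+ n)    = trans (⊖-homo n (suc m)) (+-comm _ _)
  +-homo -[1+ m ] -[1+ n ] = begin
    - (suc (suc (m ℕ.+ n)) · 1#)       ≈⟨ -‿cong (1+× (suc (m ℕ.+ n)) 1#) ⟩
    - (1# + suc (m ℕ.+ n) · 1#)        ≈⟨ -‿cong (+-congˡ (×-homo-+ 1# (suc m) n)) ⟩
    - (1# + (suc m · 1# + n · 1#))     ≈⟨ -‿cong (+-assoc _ _ _) ⟨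
    - (1# + suc m · 1# + n · 1#)       ≈⟨ -‿cong (+-congʳ (+-comm _ _)) ⟩
    - (suc m · 1# + 1# + n · 1#)       ≈⟨ -‿cong (+-assoc _ _ _) ⟩
    - (suc m · 1# + (1# + n · 1#))     ≈⟨ -‿cong (+-congˡ (1+× n 1#)) ⟨
    - (suc m · 1# + suc n · 1#)        ≈⟨ ⁻¹-∙-comm _ _ ⟨
    - (suc m · 1#) - suc n · 1#        ∎

  +◃-homo : ∀ n → ⟦ Sign.+ ℤ.◃ n ⟧ ≈ n · 1#
  +◃-homo zero    = refl
  +◃-homo (suc n) = refl

  -◃-homo : ∀ n → ⟦ Sign.- ℤ.◃ n ⟧ ≈ - (n · 1#)
  -◃-homo zero    = sym ε⁻¹≈ε
  -◃-homo (suc n) = refl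

  *-homo : ∀ i j → ⟦ i ℤ.* j ⟧ ≈ ⟦ i ⟧ * ⟦ j ⟧
  *-homo (+ m)    (+ n)    = trans (+◃-homo (m ℕ.* n)) (×1-homo-* m n)
  *-homo (+ m)    -[1+ n ] = begin
    ⟦ Sign.- ℤ.◃ m ℕ.* suc n ⟧   ≈⟨ -◃-homo (m ℕ.* suc n) ⟩
    - ((m ℕ.* suc n) · 1#)       ≈⟨ -‿cong (×1-homo-* m (suc n)) ⟩
    - ((m · 1#) * (suc n · 1#))  ≈⟨ -‿distribʳ-* _ _ ⟩
    m · 1# * - (suc n · 1#)      ∎
  *-homo -[1+ m ] (+ n)    = begin
    ⟦ Sign.- ℤ.◃ suc m ℕ.* n ⟧   ≈⟨ -◃-homo (suc m ℕ.* n) ⟩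
    - ((suc m ℕ.* n) · 1#)       ≈⟨ -‿cong (×1-homo-* (suc m) n) ⟩
    - ((suc m · 1#) * (n · 1#))  ≈⟨ -‿distribˡ-* _ _ ⟩
    - (suc m · 1#) * (n · 1#)    ∎
  *-homo -[1+ m ] -[1+ n ] = begin
    (suc m ℕ.* suc n) · 1#              ≈⟨ ×1-homo-* (suc m) (suc n) ⟩
    (suc m · 1#) * (suc n · 1#)         ≈⟨ ⁻¹-involutive _ ⟨
    - - ((suc m · 1#) * (suc n · 1#))   ≈⟨ -‿cong (-‿distribˡ-* _ _) ⟩
    - (- (suc m · 1#) * (suc n · 1#))   ≈⟨ -‿distribʳ-* _ _ ⟩
    - (suc m · 1#) * - (suc n · 1#)     ∎

  homomorphism : ℤ.+-*-rawRing -Raw-AlmostCommutative⟶ fromCommutativeRing R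
  homomorphism = record
    { ⟦_⟧    = ⟦_⟧
    ; +-homo = +-homo
    ; *-homo = *-homo
    ; -‿homo = neg-homo
    ; 0-homo = refl
    ; 1-homo = refl
    }

  _coeff≟_ : ∀ i j → Maybe (⟦ i ⟧ ≈ ⟦ j ⟧)
  i coeff≟ j = map (λ i≡j → reflexive (≡.cong ⟦_⟧ i≡j)) (dec⇒maybe (i ℤ.≟ j))

  open RingSolver ℤ.+-*-rawRing (fromCommutativeRing R) homomorphism _coeff≟_ public
    using (solve; _:=_; _:+_; _:*_; _:-_; :-_; con)

-- Arithmetic of ordered fields

module OrderedField (ℝ : CompleteOrderedField) where

  open CompleteOrderedField ℝ
  open IntegerRingSolver commutativeRing public
    using (solve; _:=_; _:+_; _:*_; _:-_; :-_; con)
  open TotalOrder totalOrder public using (poset)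
    renaming (refl to ≤-refl; reflexive to ≤-reflexive; trans to ≤-trans;
              antisym to ≤-antisym; total to ≤-total)
  open TotalOrderProperties totalOrder public using (≰⇒>; <-irrefl; <⇒≱)
  open Exp semiring public using (^-homo-*)
  open Mult semiring using (×-congʳ; ×-assoc-*)
  open PartialOrderReasoning poset

  <⇒≤ : ∀ {x y} → x < y → x ≤ y
  <⇒≤ = proj₁

  +-cancelˡ : ∀ z {x y} → z + x ≈ z + y → x ≈ y
  +-cancelˡ z {x} {y} eq = begin-equality
    x           ≈⟨ solve 2 (λ z x → x := (z :+ x) :- z) refl z x ⟩
    (z + x) - z ≈⟨ +-congʳ eq ⟩
    (z + y) - z ≈⟨ solve 2 (λ z x → (z :+ x) :- z := x) refl z y ⟩
    y           ∎

  -- Transports an inequality along the equation b - a = y - x, which is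
  -- stated without subtraction.
  shift-≤ : ∀ {x y a b} → x ≤ y → b + x ≈ a + y → a ≤ b
  shift-≤ {x} {y} {a} {b} x≤y eq = begin
    a           ≈⟨ solve 2 (λ a x → a := x :+ (a :- x)) refl a x ⟩
    x + (a - x) ≤⟨ +-monoˡ-≤ (a - x) x≤y ⟩
    y + (a - x) ≈⟨ solve 3 (λ a x y → y :+ (a :- x) := (a :+ y) :- x) refl a x y ⟩
    (a + y) - x ≈⟨ +-congʳ eq ⟨
    (b + x) - x ≈⟨ solve 2 (λ b x → (b :+ x) :- x := b) refl b x ⟩
    b           ∎

  shift-< : ∀ {x y a b} → x < y → b + x ≈ a + y → a < b
  shift-< {x} {y} {a} (x≤y , x≉y) eq =
    shift-≤ x≤y eq , λ a≈b → x≉y (+-cancelˡ a (trans (+-congʳ a≈b) eq))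

  +-mono-≤ : ∀ {x y u v} → x ≤ y → u ≤ v → x + u ≤ y + v
  +-mono-≤ {x} {y} {u} {v} x≤y u≤v = begin
    x + u ≤⟨ +-monoˡ-≤ u x≤y ⟩
    y + u ≈⟨ +-comm y u ⟩
    u + y ≤⟨ +-monoˡ-≤ y u≤v ⟩
    v + y ≈⟨ +-comm v y ⟩
    y + v ∎

  x≤y⇒0≤y-x : ∀ {x y} → x ≤ y → 0# ≤ y - x
  x≤y⇒0≤y-x {x} {y} x≤y = shift-≤ x≤y (solve 2 (λ x y → (y :- x) :+ x := con (+ 0) :+ y) refl x y)

  x<y⇒0<y-x : ∀ {x y} → x < y → 0# < y - x
  x<y⇒0<y-x {x} {y} x<y = shift-< x<y (solve 2 (λ x y → (y :- x) :+ x := con (+ 0) :+ y) refl x y)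

  *-monoˡ-≤ : ∀ {x y z} → 0# ≤ z → x ≤ y → z * x ≤ z * y
  *-monoˡ-≤ {x} {y} {z} 0≤z x≤y = shift-≤ (*-nonNeg 0≤z (x≤y⇒0≤y-x x≤y))
    (solve 3 (λ x y z → z :* y :+ con (+ 0) := z :* x :+ z :* (y :- x)) refl x y z)

  *-monoʳ-≤ : ∀ {x y z} → 0# ≤ z → x ≤ y → x * z ≤ y * z
  *-monoʳ-≤ {x} {y} {z} 0≤z x≤y = begin
    x * z ≈⟨ *-comm x z ⟩
    z * x ≤⟨ *-monoˡ-≤ 0≤z x≤y ⟩
    z * y ≈⟨ *-comm z y ⟩
    y * z ∎

  *-mono-≤ : ∀ {x y u v} → 0# ≤ x → 0# ≤ u → x ≤ y → u ≤ v → x * u ≤ y * v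
  *-mono-≤ 0≤x 0≤u x≤y u≤v =
    ≤-trans (*-monoʳ-≤ 0≤u x≤y) (*-monoˡ-≤ (≤-trans 0≤x x≤y) u≤v)

  0≤1 : 0# ≤ 1#
  0≤1 with ≤-total 0# 1#
  ... | inj₁ 0≤1 = 0≤1
  ... | inj₂ 1≤0 = begin
    0#          ≤⟨ *-nonNeg 0≤-1 0≤-1 ⟩
    - 1# * - 1# ≈⟨ solve 0 (:- con (+ 1) :* :- con (+ 1) := con (+ 1)) refl ⟩
    1#          ∎
    where
    0≤-1 : 0# ≤ - 1#
    0≤-1 = shift-≤ 1≤0 (solve 0 (:- con (+ 1) :+ con (+ 1) := con (+ 0) :+ con (+ 0)) refl)

  0<1 : 0# < 1#
  0<1 = 0≤1 , 0≉1

  0<x⇒x≉0 : ∀ {x} → 0# < x → ¬ x ≈ 0#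
  0<x⇒x≉0 0<x x≈0 = proj₂ 0<x (sym x≈0)

  *-cancelˡ : ∀ {z x y} → ¬ z ≈ 0# → z * x ≈ z * y → x ≈ y
  *-cancelˡ {z} {x} {y} z≉0 eq with invertible z z≉0
  ... | z⁻¹ , z⁻¹z≈1 , _ = begin-equality
    x             ≈⟨ *-identityˡ x ⟨
    1# * x        ≈⟨ *-congʳ z⁻¹z≈1 ⟨
    z⁻¹ * z * x   ≈⟨ *-assoc _ _ _ ⟩
    z⁻¹ * (z * x) ≈⟨ *-congˡ eq ⟩
    z⁻¹ * (z * y) ≈⟨ *-assoc _ _ _ ⟨
    z⁻¹ * z * y   ≈⟨ *-congʳ z⁻¹z≈1 ⟩
    1# * y        ≈⟨ *-identityˡ y ⟩
    y             ∎

  *-pos : ∀ {x y} → 0# < x → 0# < y → 0# < x * y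
  *-pos {x} 0<x 0<y = *-nonNeg (<⇒≤ 0<x) (<⇒≤ 0<y) ,
    λ 0≈xy → proj₂ 0<y (*-cancelˡ (0<x⇒x≉0 0<x) (trans (zeroʳ x) 0≈xy))

  *-monoˡ-< : ∀ {x y z} → 0# < z → x < y → z * x < z * y
  *-monoˡ-< {x} {y} {z} 0<z (x≤y , x≉y) =
    *-monoˡ-≤ (<⇒≤ 0<z) x≤y , x≉y ∘ *-cancelˡ (0<x⇒x≉0 0<z)

  *-cancelˡ-≤ : ∀ {z x y} → 0# < z → z * x ≤ z * y → x ≤ y
  *-cancelˡ-≤ {z} {x} {y} 0<z zx≤zy with ≤-total x y
  ... | inj₁ x≤y = x≤y
  ... | inj₂ y≤x = ≤-reflexive
    (*-cancelˡ (0<x⇒x≉0 0<z) (≤-antisym zx≤zy (*-monoˡ-≤ (<⇒≤ 0<z) y≤x)))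

  *-cancelˡ-< : ∀ {z x y} → 0# < z → z * x < z * y → x < y
  *-cancelˡ-< 0<z (zx≤zy , zx≉zy) = *-cancelˡ-≤ 0<z zx≤zy , zx≉zy ∘ *-congˡ

  x<x+1 : ∀ x → x < x + 1#
  x<x+1 x = shift-< 0<1 (solve 1 (λ x → x :+ con (+ 1) :+ con (+ 0) := x :+ con (+ 1)) refl x)

  +-nonNeg : ∀ {x y} → 0# ≤ x → 0# ≤ y → 0# ≤ x + y
  +-nonNeg 0≤x 0≤y = ≤-trans (≤-reflexive (sym (+-identityˡ 0#))) (+-mono-≤ 0≤x 0≤y)

  x≤x+y : ∀ {x y} → 0# ≤ y → x ≤ x + y
  x≤x+y {x} 0≤y = ≤-trans (≤-reflexive (sym (+-identityʳ x))) (+-mono-≤ ≤-refl 0≤y)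

  ·≈fromℕ* : ∀ n x → n · x ≈ fromℕ n * x
  ·≈fromℕ* n x = begin-equality
    n · x         ≈⟨ ×-congʳ n (*-identityˡ x) ⟨
    n · (1# * x)  ≈⟨ ×-assoc-* n 1# x ⟨
    fromℕ n * x   ∎

  fromℕ-nonNeg : ∀ n → 0# ≤ fromℕ n
  fromℕ-nonNeg zero    = ≤-refl
  fromℕ-nonNeg (suc n) = +-nonNeg 0≤1 (fromℕ-nonNeg n)

  fromℕ-mono-≤ : ∀ {m n} → m ℕ.≤ n → fromℕ m ≤ fromℕ n
  fromℕ-mono-≤ {n = n} z≤n = fromℕ-nonNeg n
  fromℕ-mono-≤ (s≤s m≤n)   = +-mono-≤ ≤-refl (fromℕ-mono-≤ m≤n)

  fromℕ-suc-pos : ∀ n → 0# < fromℕ (suc n)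
  fromℕ-suc-pos n = begin-strict
    0#            <⟨ 0<1 ⟩
    1#            ≤⟨ x≤x+y (fromℕ-nonNeg n) ⟩
    fromℕ (suc n) ∎

  fromℕ-cancel-< : ∀ {m n} → fromℕ m < fromℕ n → m ℕ.< n
  fromℕ-cancel-< m<n = ℕ.≰⇒> λ n≤m → <⇒≱ m<n (fromℕ-mono-≤ n≤m)

  ^-nonNeg : ∀ {x} n → 0# ≤ x → 0# ≤ x ^ n
  ^-nonNeg zero    0≤x = 0≤1
  ^-nonNeg (suc n) 0≤x = *-nonNeg 0≤x (^-nonNeg n 0≤x)

  ^-monoˡ-≤ : ∀ {x y} n → 0# ≤ x → x ≤ y → x ^ n ≤ y ^ n
  ^-monoˡ-≤ zero    0≤x x≤y = ≤-refl
  ^-monoˡ-≤ (suc n) 0≤x x≤y = *-mono-≤ 0≤x (^-nonNeg n 0≤x) x≤y (^-monoˡ-≤ n 0≤x x≤y)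

  1≤x^n : ∀ {x} n → 1# ≤ x → 1# ≤ x ^ n
  1≤x^n zero        1≤x = ≤-refl
  1≤x^n {x} (suc n) 1≤x = begin
    1#        ≈⟨ *-identityˡ 1# ⟨
    1# * 1#   ≤⟨ *-mono-≤ 0≤1 0≤1 1≤x (1≤x^n n 1≤x) ⟩
    x * x ^ n ∎

  ^-monoʳ-≤ : ∀ {x m n} → 1# ≤ x → m ℕ.≤ n → x ^ m ≤ x ^ n
  ^-monoʳ-≤ {n = n} 1≤x z≤n = 1≤x^n n 1≤x
  ^-monoʳ-≤ 1≤x (s≤s m≤n)   = *-monoˡ-≤ (≤-trans 0≤1 1≤x) (^-monoʳ-≤ 1≤x m≤n)

  ^-pos : ∀ {x} n → 0# < x → 0# < x ^ n
  ^-pos zero    0<x = 0<1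
  ^-pos (suc n) 0<x = *-pos 0<x (^-pos n 0<x)

  ^-monoˡ-< : ∀ {x y} n → 0# < x → x < y → x ^ suc n < y ^ suc n
  ^-monoˡ-< {x} {y} n 0<x x<y = begin-strict
    x * x ^ n ≈⟨ *-comm _ _ ⟩
    x ^ n * x <⟨ *-monoˡ-< (^-pos n 0<x) x<y ⟩
    x ^ n * y ≈⟨ *-comm _ _ ⟩
    y * x ^ n ≤⟨ *-monoˡ-≤ (≤-trans (<⇒≤ 0<x) (<⇒≤ x<y)) (^-monoˡ-≤ n (<⇒≤ 0<x) (<⇒≤ x<y)) ⟩
    y * y ^ n ∎

  1^n≈1 : ∀ n → 1# ^ n ≈ 1#
  1^n≈1 zero    = refl
  1^n≈1 (suc n) = trans (*-identityˡ _) (1^n≈1 n)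

  bernoulli : ∀ {s} n → 0# ≤ s → 1# + fromℕ n * s ≤ (1# + s) ^ n
  bernoulli {s} zero    0≤s = ≤-reflexive (solve 1 (λ s → con (+ 1) :+ con (+ 0) :* s := con (+ 1)) refl s)
  bernoulli {s} (suc n) 0≤s = begin
    1# + (1# + fromℕ n) * s        ≤⟨ shift-≤ (*-nonNeg (fromℕ-nonNeg n) (*-nonNeg 0≤s 0≤s))
                                        (solve 2 (λ s n →
                                        (con (+ 1) :+ s) :* (con (+ 1) :+ n :* s) :+ con (+ 0)
                                        := (con (+ 1) :+ (con (+ 1) :+ n) :* s) :+ n :* (s :* s))
                                        refl s (fromℕ n)) ⟩
    (1# + s) * (1# + fromℕ n * s)  ≤⟨ *-monoˡ-≤ (+-nonNeg 0≤1 0≤s) (bernoulli n 0≤s) ⟩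
    (1# + s) * (1# + s) ^ n        ∎

  -- Stands in for continuity of powers in the construction of roots: `K` depends only on `n` and
  -- `M`. In the induction, b (A + K (b - a)) = a A + (A + b K) (b - a) with A = `a ^ n`, and the
  -- factor A + b K is at most `M ^ n + M * K`.
  ^-lipschitz : ∀ n {M} → 0# ≤ M → ∃ λ K → 0# ≤ K ×
    (∀ {a b} → 0# ≤ a → a ≤ b → b ≤ M → b ^ n ≤ a ^ n + K * (b - a))
  ^-lipschitz zero    0≤M = 0# , ≤-refl , λ {a} {b} _ _ _ → ≤-reflexive
    (solve 2 (λ a b → con (+ 1) := con (+ 1) :+ con (+ 0) :* (b :- a)) refl a b)
  ^-lipschitz (suc n) {M} 0≤M with ^-lipschitz n 0≤M
  ... | K , 0≤K , lip = M ^ n + M * K , +-nonNeg (^-nonNeg n 0≤M) (*-nonNeg 0≤M 0≤K) ,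
    λ {a} {b} 0≤a a≤b b≤M → begin
      b * b ^ n
        ≤⟨ *-monoˡ-≤ (≤-trans 0≤a a≤b) (lip 0≤a a≤b b≤M) ⟩
      b * (a ^ n + K * (b - a))
        ≈⟨ solve 4 (λ a b K A → b :* (A :+ K :* (b :- a)) := a :* A :+ (A :+ b :* K) :* (b :- a)) refl a b K (a ^ n) ⟩
      a * a ^ n + (a ^ n + b * K) * (b - a)
        ≤⟨ +-mono-≤ ≤-refl (*-monoʳ-≤ (x≤y⇒0≤y-x a≤b)
             (+-mono-≤ (^-monoˡ-≤ n 0≤a (≤-trans a≤b b≤M)) (*-monoʳ-≤ 0≤K b≤M))) ⟩
      a * a ^ n + (M ^ n + M * K) * (b - a)
        ∎

-- Real numbers: Archimedean property, floor, roots and growth of powers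

module RealProperties (em : ExcludedMiddle 0ℓ) (ℝ : CompleteOrderedField) where

  open CompleteOrderedField ℝ
  open Real em ℝ
  open OrderedField ℝ
  open PartialOrderReasoning poset

  choose-spec : {A : Set} (default : A) (P : Pred A 0ℓ) → ∃ P → P (choose default P)
  choose-spec default P ∃P with em {∃ P}
  ... | yes (_ , Px) = Px
  ... | no  ¬∃P      = ⊥-elim (¬∃P ∃P)

  -- Totality yields two weak inequalities; excluded middle makes one of them strict.
  ≤⊎> : ∀ x y → x ≤ y ⊎ y < x
  ≤⊎> x y with em {x ≤ y}
  ... | yes x≤y = inj₁ x≤y
  ... | no  x≰y = inj₂ (≰⇒> x≰y)

  ≮⇒≥ : ∀ {x y} → ¬ x < y → y ≤ x
  ≮⇒≥ {x} {y} x≮y with ≤⊎> y x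
  ... | inj₁ y≤x = y≤x
  ... | inj₂ x<y = ⊥-elim (x≮y x<y)

  ⁻¹-inverse : ∀ {x} → ¬ x ≈ 0# → x * x ⁻¹ ≈ 1#
  ⁻¹-inverse {x} x≉0 with invertible x x≉0
  ... | y , _ , xy≈1 = choose-spec 0# (λ y → x * y ≈ 1#) (y , xy≈1)

  ⁻¹-pos : ∀ {x} → 0# < x → 0# < x ⁻¹
  ⁻¹-pos {x} 0<x = *-cancelˡ-< 0<x (begin-strict
    x * 0#    ≈⟨ zeroʳ x ⟩
    0#        <⟨ 0<1 ⟩
    1#        ≈⟨ ⁻¹-inverse (0<x⇒x≉0 0<x) ⟨
    x * x ⁻¹  ∎)

  y*[x/y]≈x : ∀ {y} x → ¬ y ≈ 0# → y * (x / y) ≈ x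
  y*[x/y]≈x {y} x y≉0 = begin-equality
    y * (x / y) ≈⟨ solve 3 (λ y x z → y :* (x :* z) := x :* (y :* z)) refl y x (y ⁻¹) ⟩
    x * (y / y) ≈⟨ *-congˡ (⁻¹-inverse y≉0) ⟩
    x * 1#      ≈⟨ *-identityʳ x ⟩
    x           ∎

  /-pos : ∀ {x y} → 0# < x → 0# < y → 0# < x / y
  /-pos 0<x 0<y = *-pos 0<x (⁻¹-pos 0<y)

  -- If the naturals were bounded, they would have a supremum `s`. Since n + 1 ≤ s for every n,
  -- `s - 1#` would be an upper bound too, contradicting leastness.
  archimedean : ∀ x → ∃ λ n → x < fromℕ n
  archimedean x with em {∃ λ n → x < fromℕ n}
  ... | yes found = found
  ... | no  ¬∃    = ⊥-elim (<⇒≱ (x<x+1 (s - 1#)) (≤-trans (≤-reflexive s-1+1≈s) s≤s-1))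
    where
    IsNatural : Pred Carrier 0ℓ
    IsNatural y = ∃ λ n → y ≈ fromℕ n

    bounded : IsUpperBound IsNatural x
    bounded y (n , y≈n) = ≤-trans (≤-reflexive y≈n) (≮⇒≥ λ x<n → ¬∃ (n , x<n))

    supremum = complete IsNatural (0# , 0 , refl) (x , bounded)
    s = proj₁ supremum

    s-1+1≈s : s - 1# + 1# ≈ s
    s-1+1≈s = solve 1 (λ s → s :- con (+ 1) :+ con (+ 1) := s) refl s

    s≤s-1 : s ≤ s - 1#
    s≤s-1 = proj₂ (proj₂ supremum) (s - 1#) λ y (n , y≈n) →
      shift-≤ (proj₁ (proj₂ supremum) (fromℕ (suc n)) (suc n , refl))
        (begin-equality
          (s - 1#) + (1# + fromℕ n) ≈⟨ solve 2 (λ s n → s :- con (+ 1) :+ (con (+ 1) :+ n) := n :+ s) refl s (fromℕ n) ⟩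
          fromℕ n + s               ≈⟨ +-congʳ y≈n ⟨
          y + s                     ∎)

  ⌊⌋-spec : ∀ {x} → 0# ≤ x → fromℕ ⌊ x ⌋ ≤ x × x < fromℕ (suc ⌊ x ⌋)
  ⌊⌋-spec {x} 0≤x = choose-spec 0 (λ k → fromℕ k ≤ x × x < fromℕ (suc k))
    (search (proj₁ (archimedean x)) (proj₂ (archimedean x)))
    where
    -- Descends from an Archimedean bound to the first `k` with `fromℕ k ≤ x`; the descent stops at
    -- 0 because `x` is nonnegative.
    search : ∀ n → x < fromℕ n → ∃ λ k → fromℕ k ≤ x × x < fromℕ (suc k)
    search zero    x<0 = ⊥-elim (<⇒≱ x<0 0≤x)
    search (suc n) x<n with ≤⊎> (fromℕ n) x
    ... | inj₁ n≤x = n , n≤x , x<n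
    ... | inj₂ x<n = search n x<n

  -- The minimum of d / (K + 1) and 1 works; the added 1 avoids division by zero and makes the last
  -- inequality strict.
  small-step : ∀ {K d} → 0# ≤ K → 0# < d → ∃ λ δ → 0# < δ × δ ≤ 1# × K * δ < d
  small-step {K} {d} 0≤K 0<d = pick (≤-total δ 1#)
    where
    0<K+1 : 0# < K + 1#
    0<K+1 = begin-strict 0# ≤⟨ 0≤K ⟩ K <⟨ x<x+1 K ⟩ K + 1# ∎

    δ : Carrier
    δ = d / (K + 1#)

    pick : δ ≤ 1# ⊎ 1# ≤ δ → ∃ λ δ → 0# < δ × δ ≤ 1# × K * δ < d
    pick (inj₁ δ≤1) = δ , /-pos 0<d 0<K+1 , δ≤1 , (begin-strict
      K * δ         <⟨ shift-< (/-pos 0<d 0<K+1) (solve 2 (λ K δ →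
                         (K :+ con (+ 1)) :* δ :+ con (+ 0) := K :* δ :+ δ) refl K δ) ⟩
      (K + 1#) * δ  ≈⟨ y*[x/y]≈x d (0<x⇒x≉0 0<K+1) ⟩
      d             ∎)
    pick (inj₂ 1≤δ) = 1# , 0<1 , ≤-refl , (begin-strict
      K * 1#        ≈⟨ *-identityʳ K ⟩
      K             <⟨ x<x+1 K ⟩
      K + 1#        ≈⟨ *-identityʳ _ ⟨
      (K + 1#) * 1# ≤⟨ *-monoˡ-≤ (<⇒≤ 0<K+1) 1≤δ ⟩
      (K + 1#) * δ  ≈⟨ y*[x/y]≈x d (0<x⇒x≉0 0<K+1) ⟩
      d             ∎)

  -- The maximum of `x` and y / 2 works. Here `x` may be negative, so `x` itself need not be
  -- positive.
  between : ∀ {x y} → 0# < y → x < y → ∃ λ z → 0# < z × x ≤ z × z < y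
  between {x} {y} 0<y x<y = pick (≤-total x half)
    where
    half : Carrier
    half = y / (1# + 1#)

    0<2 : 0# < 1# + 1#
    0<2 = begin-strict 0# <⟨ 0<1 ⟩ 1# <⟨ x<x+1 1# ⟩ 1# + 1# ∎

    0<half : 0# < half
    0<half = /-pos 0<y 0<2

    half+half : half + half ≈ y
    half+half = begin-equality
      half + half      ≈⟨ solve 1 (λ h → h :+ h := (con (+ 1) :+ con (+ 1)) :* h) refl half ⟩
      (1# + 1#) * half ≈⟨ y*[x/y]≈x y (0<x⇒x≉0 0<2) ⟩
      y                ∎

    pick : x ≤ half ⊎ half ≤ x → ∃ λ z → 0# < z × x ≤ z × z < y
    pick (inj₁ x≤h) = half , 0<half , x≤h , shift-< 0<half (trans (+-identityʳ y) (sym half+half))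
    pick (inj₂ h≤x) = x , (begin-strict 0# <⟨ 0<half ⟩ half ≤⟨ h≤x ⟩ x ∎) , ≤-refl , x<y

  module _ (n : ℕ) {x : Carrier} (0≤x : 0# ≤ x) where
    private
      IsSubroot : Pred Carrier 0ℓ
      IsSubroot y = 0# ≤ y × y ^ suc n ≤ x

      0-subroot : IsSubroot 0#
      0-subroot = ≤-refl , ≤-trans (≤-reflexive (zeroˡ (0# ^ n))) 0≤x

      -- A number above x + 1 is at least 1, so its positive powers are at least itself and exceed
      -- `x`.
      bounded : IsUpperBound IsSubroot (x + 1#)
      bounded y (_ , yⁿ≤x) = ≮⇒≥ λ x+1<y →
        let 1≤y : 1# ≤ y
            1≤y = begin
              1#     ≤⟨ x≤x+y 0≤x ⟩
              1# + x ≈⟨ +-comm 1# x ⟩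
              x + 1# ≤⟨ <⇒≤ x+1<y ⟩
              y      ∎
        in <⇒≱ (x<x+1 x) (begin
          x + 1#    ≤⟨ <⇒≤ x+1<y ⟩
          y         ≈⟨ *-identityʳ y ⟨
          y * 1#    ≤⟨ *-monoˡ-≤ (≤-trans 0≤1 1≤y) (1≤x^n n 1≤y) ⟩
          y * y ^ n ≤⟨ yⁿ≤x ⟩
          x         ∎)

    module _ {s : Carrier} (upper : IsUpperBound IsSubroot s)
             (least : ∀ b → IsUpperBound IsSubroot b → s ≤ b) where
      private
        0≤s : 0# ≤ s
        0≤s = upper 0# 0-subroot

        -- Otherwise the Lipschitz estimate gives a small δ for which `s - δ` still bounds all
        -- subroots, so `s` is not least.
        sⁿ≤x : s ^ suc n ≤ x
        sⁿ≤x = ≮⇒≥ λ x<sⁿ →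
          let K , 0≤K , lip     = ^-lipschitz (suc n) 0≤s
              δ , 0<δ , _ , Kδ<d = small-step 0≤K (x<y⇒0<y-x x<sⁿ)
              lower : IsUpperBound IsSubroot (s - δ)
              lower y (0≤y , yⁿ≤x) = ≮⇒≥ λ s-δ<y → <-irrefl refl (begin-strict
                s ^ suc n               ≤⟨ lip 0≤y (upper y (0≤y , yⁿ≤x)) ≤-refl ⟩
                y ^ suc n + K * (s - y) ≤⟨ +-mono-≤ yⁿ≤x (*-monoˡ-≤ 0≤K (shift-≤ (<⇒≤ s-δ<y)
                                             (solve 3 (λ s y δ → δ :+ (s :- δ) := s :- y :+ y) refl s y δ))) ⟩
                x + K * δ               <⟨ shift-< Kδ<d (solve 3 (λ x p S → S :+ p := x :+ p :+ (S :- x))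
                                             refl x (K * δ) (s ^ suc n)) ⟩
                s ^ suc n               ∎)
          in <⇒≱ 0<δ (shift-≤ (least (s - δ) lower)
               (solve 2 (λ s δ → con (+ 0) :+ s := δ :+ (s :- δ)) refl s δ))

        -- Otherwise `s + δ` is still a subroot for small δ. The estimate is taken on [0, s + 1],
        -- which is why δ ≤ 1 is required.
        x≤sⁿ : x ≤ s ^ suc n
        x≤sⁿ = ≮⇒≥ λ sⁿ<x →
          let K , 0≤K , lip        = ^-lipschitz (suc n) (+-nonNeg 0≤s 0≤1)
              δ , 0<δ , δ≤1 , Kδ<d = small-step 0≤K (x<y⇒0<y-x sⁿ<x)
              subroot : (s + δ) ^ suc n ≤ x
              subroot = begin
                (s + δ) ^ suc n             ≤⟨ lip 0≤s (x≤x+y (<⇒≤ 0<δ)) (+-mono-≤ ≤-refl δ≤1) ⟩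
                s ^ suc n + K * (s + δ - s) ≈⟨ +-congˡ (*-congˡ (solve 2 (λ s δ → s :+ δ :- s := δ) refl s δ)) ⟩
                s ^ suc n + K * δ           ≤⟨ shift-≤ (<⇒≤ Kδ<d) (solve 3 (λ x p S → x :+ p := S :+ p :+ (x :- S))
                                                 refl x (K * δ) (s ^ suc n)) ⟩
                x                           ∎
          in <⇒≱ 0<δ (shift-≤ (upper (s + δ) (+-nonNeg 0≤s (<⇒≤ 0<δ) , subroot))
               (solve 2 (λ s δ → con (+ 0) :+ (s :+ δ) := δ :+ s) refl s δ))

      supremum-root : 0# ≤ s × s ^ suc n ≈ x
      supremum-root = 0≤s , ≤-antisym sⁿ≤x x≤sⁿ

    root-spec : 0# ≤ root (suc n) x × root (suc n) x ^ suc n ≈ x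
    root-spec = choose-spec 0# (λ y → 0# ≤ y × y ^ suc n ≈ x)
      (let s , upper , least = complete IsSubroot (0# , 0-subroot) (x + 1# , bounded)
       in s , supremum-root upper least)

  -- By Bernoulli's inequality any n > x / s will do.
  powers-unbounded : ∀ {s} → 0# < s → ∀ x → ∃ λ n → x < (1# + s) ^ n
  powers-unbounded {s} 0<s x with archimedean (x / s)
  ... | n , x/s<n = n , (begin-strict
    x                ≈⟨ y*[x/y]≈x x (0<x⇒x≉0 0<s) ⟨
    s * (x / s)      <⟨ *-monoˡ-< 0<s x/s<n ⟩
    s * fromℕ n      ≈⟨ *-comm _ _ ⟩
    fromℕ n * s      ≤⟨ x≤x+y 0≤1 ⟩
    fromℕ n * s + 1# ≈⟨ +-comm _ _ ⟩
    1# + fromℕ n * s ≤⟨ bernoulli n (<⇒≤ 0<s) ⟩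
    (1# + s) ^ n     ∎)

-- Totals over lists and finite sums

-- Serves to turn `noConflict` into plain disjointness on the pieces of one machine or one job:
-- there `P` says which machine or job it is.
allPairs-restrict : {A : Set} {P : Pred A 0ℓ} {R S : Rel A 0ℓ} →
  (∀ {x y} → P x → P y → R x y → S x y) →
  ∀ {xs} → All P xs → AllPairs R xs → AllPairs S xs
allPairs-restrict f []         []         = []
allPairs-restrict f (px ∷ pxs) (rx ∷ rxs) =
  All.zipWith (λ (py , rxy) → f px py rxy) (pxs , rx) ∷ allPairs-restrict f pxs rxs

module ListTotals (ℝ : CompleteOrderedField) where

  open CompleteOrderedField ℝ hiding (zero)
  open OrderedField ℝ
  open Sum semiring using (sum-cong-≋; sum-replicate-zero; ∑-distrib-+)
  open PartialOrderReasoning poset hiding (start; stop)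

  total : {A : Set} → (A → Carrier) → List A → Carrier
  total f xs = List.foldr _+_ 0# (List.map f xs)

  total-cong : ∀ {A : Set} {f g : A → Carrier} {xs} → All (λ x → f x ≈ g x) xs → total f xs ≈ total g xs
  total-cong []         = refl
  total-cong (eq ∷ eqs) = +-cong eq (total-cong eqs)

  total-nonNeg : ∀ {A : Set} {f : A → Carrier} {xs} → All (λ x → 0# ≤ f x) xs → 0# ≤ total f xs
  total-nonNeg []       = ≤-refl
  total-nonNeg (p ∷ ps) = +-nonNeg p (total-nonNeg ps)

  total-0 : ∀ {A : Set} {f : A → Carrier} {xs} → All (λ x → f x ≈ 0#) xs → total f xs ≈ 0#
  total-0 []       = refl
  total-0 (p ∷ ps) = trans (+-cong p (total-0 ps)) (+-identityˡ 0#)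

  sum-mono-≤ : ∀ {n} {f g : Fin n → Carrier} → (∀ i → f i ≤ g i) → sum f ≤ sum g
  sum-mono-≤ {zero}  f≤g = ≤-refl
  sum-mono-≤ {suc n} f≤g = +-mono-≤ (f≤g zero) (sum-mono-≤ (f≤g ∘ suc))

  sum-indicator : ∀ {n} (i : Fin n) x → sum (λ k → if does (i Fin.≟ k) then x else 0#) ≈ x
  sum-indicator {suc n} zero    x = trans (+-congˡ (sum-replicate-zero n)) (+-identityʳ x)
  sum-indicator {suc n} (suc i) x = trans (+-identityˡ _) (sum-indicator i x)

  -- The fibres of `key` partition the list. Applied with both the job and the machine of a piece as
  -- key, this is the double counting behind `capacity`.
  sum-total-filter : ∀ {A : Set} {n} (key : A → Fin n) (f : A → Carrier) xs →
    sum (λ k → total f (filter (λ x → key x Fin.≟ k) xs)) ≈ total f xs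
  sum-total-filter {n = n} key f []       = sum-replicate-zero n
  sum-total-filter key f (x ∷ xs) = begin-equality
    sum (λ k → total f (filter (λ y → key y Fin.≟ k) (x ∷ xs)))
      ≈⟨ sum-cong-≋ split ⟩
    sum (λ k → (if does (key x Fin.≟ k) then f x else 0#) + total f (filter (λ y → key y Fin.≟ k) xs))
      ≈⟨ ∑-distrib-+ (λ k → if does (key x Fin.≟ k) then f x else 0#) _ ⟩
    sum (λ k → if does (key x Fin.≟ k) then f x else 0#) + sum (λ k → total f (filter (λ y → key y Fin.≟ k) xs))
      ≈⟨ +-cong (sum-indicator (key x) (f x)) (sum-total-filter key f xs) ⟩
    f x + total f xs
      ∎
    where
    split : ∀ k → total f (filter (λ y → key y Fin.≟ k) (x ∷ xs)) ≈
                  (if does (key x Fin.≟ k) then f x else 0#) + total f (filter (λ y → key y Fin.≟ k) xs)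
    split k with does (key x Fin.≟ k)
    ... | true  = refl
    ... | false = sym (+-identityˡ _)

-- Disjoint intervals inside a bounded interval

module Packing (ℝ : CompleteOrderedField) {A : Set}
               (start stop : A → CompleteOrderedField.Carrier ℝ) where

  open CompleteOrderedField ℝ hiding (zero)
  open OrderedField ℝ
  open ListTotals ℝ
  open Min totalOrder using (_⊓_; x≤y⇒x⊓y≈x; x≤y⇒y⊓x≈x; ⊓-monoˡ-≤)
  open PartialOrderReasoning poset hiding (start; stop)

  Proper : Pred A 0ℓ
  Proper p = start p ≤ stop p

  Disjoint : Rel A 0ℓ
  Disjoint p q = stop p ≤ start q ⊎ stop q ≤ start p

  length : A → Carrier
  length p = stop p - start p

  -- The length of the part of `p` lying before time `x`. The minima cover intervals that end before
  -- `x`, contain `x` or start after it.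
  lengthBefore : Carrier → A → Carrier
  lengthBefore x p = stop p ⊓ x - start p ⊓ x

  lengthBefore-≤start : ∀ {x p} → Proper p → x ≤ start p → lengthBefore x p ≈ 0#
  lengthBefore-≤start {x} s≤t x≤s =
    trans (+-cong (x≤y⇒y⊓x≈x (≤-trans x≤s s≤t)) (-‿cong (x≤y⇒y⊓x≈x x≤s))) (-‿inverseʳ x)

  lengthBefore-≥stop : ∀ {x p} → Proper p → stop p ≤ x → lengthBefore x p ≈ length p
  lengthBefore-≥stop s≤t t≤x =
    +-cong (x≤y⇒x⊓y≈x t≤x) (-‿cong (x≤y⇒x⊓y≈x (≤-trans s≤t t≤x)))

  lengthBefore-inside : ∀ {x p} → start p ≤ x → x ≤ stop p → lengthBefore x p ≈ x - start p
  lengthBefore-inside s≤x x≤t = +-cong (x≤y⇒y⊓x≈x x≤t) (-‿cong (x≤y⇒x⊓y≈x s≤x))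

  lengthBefore-nonNeg : ∀ {x p} → Proper p → 0# ≤ lengthBefore x p
  lengthBefore-nonNeg {x} s≤t = x≤y⇒0≤y-x (⊓-monoˡ-≤ x s≤t)

  -- While `p` is running, an interval disjoint from it gains no length.
  lengthBefore-constant : ∀ {a b p q} → Proper q → Disjoint p q →
    start p ≤ a → a ≤ b → b ≤ stop p → lengthBefore a q ≈ lengthBefore b q
  lengthBefore-constant u≤v (inj₁ t≤u) s≤a a≤b b≤t =
    trans (lengthBefore-≤start u≤v (≤-trans a≤b (≤-trans b≤t t≤u)))
          (sym (lengthBefore-≤start u≤v (≤-trans b≤t t≤u)))
  lengthBefore-constant u≤v (inj₂ v≤s) s≤a a≤b b≤t =
    trans (lengthBefore-≥stop u≤v (≤-trans v≤s s≤a))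
          (sym (lengthBefore-≥stop u≤v (≤-trans v≤s (≤-trans s≤a a≤b))))

  -- The part of disjoint intervals lying in [a, b] has length at most b - a,
  -- stated without subtraction.  Splitting [a, b] at the ends of the first
  -- interval reduces this to the remaining intervals.
  packing : ∀ {xs} → All Proper xs → AllPairs Disjoint xs → ∀ {a b} → a ≤ b →
            total (lengthBefore b) xs + a ≤ total (lengthBefore a) xs + b
  packing []                []               a≤b = +-mono-≤ ≤-refl a≤b
  packing {p ∷ xs} (s≤t ∷ ss≤ts) (p# ∷ #s) = whole
    where
    Bound : Carrier → Carrier → Set
    Bound a b = lengthBefore b p + total (lengthBefore b) xs + a
              ≤ lengthBefore a p + total (lengthBefore a) xs + b

    -- Adding the two bounds, the terms at `b` cancel, so the bound may be proved on consecutive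
    -- subintervals.
    glue : ∀ {a b c} → Bound a b → Bound b c → Bound a c
    glue {a} {b} {c} ab bc = shift-≤ (+-mono-≤ ab bc)
      (solve 6 (λ a b c A B C → (A :+ c) :+ ((B :+ a) :+ (C :+ b)) := (C :+ a) :+ ((A :+ b) :+ (B :+ c)))
        refl a b c
        (lengthBefore a p + total (lengthBefore a) xs) (lengthBefore b p + total (lengthBefore b) xs)
        (lengthBefore c p + total (lengthBefore c) xs))

    flat : ∀ {a b} → a ≤ b → lengthBefore a p ≈ lengthBefore b p → Bound a b
    flat {a} {b} a≤b eq = begin
      lengthBefore b p + total (lengthBefore b) xs + a   ≈⟨ +-assoc _ _ _ ⟩
      lengthBefore b p + (total (lengthBefore b) xs + a) ≤⟨ +-mono-≤ (≤-reflexive (sym eq)) (packing ss≤ts #s a≤b) ⟩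
      lengthBefore a p + (total (lengthBefore a) xs + b) ≈⟨ +-assoc _ _ _ ⟨
      lengthBefore a p + total (lengthBefore a) xs + b   ∎

    left : ∀ {a b} → a ≤ b → b ≤ start p → Bound a b
    left a≤b b≤s = flat a≤b
      (trans (lengthBefore-≤start s≤t (≤-trans a≤b b≤s)) (sym (lengthBefore-≤start s≤t b≤s)))

    right : ∀ {a b} → stop p ≤ a → a ≤ b → Bound a b
    right t≤a a≤b = flat a≤b
      (trans (lengthBefore-≥stop s≤t t≤a) (sym (lengthBefore-≥stop s≤t (≤-trans t≤a a≤b))))

    -- Inside `p` equality holds: `p` accounts for all of b - a and the other intervals contribute
    -- nothing.
    middle : ∀ {a b} → start p ≤ a → a ≤ b → b ≤ stop p → Bound a b
    middle {a} {b} s≤a a≤b b≤t = ≤-reflexive (begin-equality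
      lengthBefore b p + total (lengthBefore b) xs + a
        ≈⟨ +-congʳ (+-cong (lengthBefore-inside (≤-trans s≤a a≤b) b≤t) constant) ⟩
      b - start p + total (lengthBefore a) xs + a
        ≈⟨ solve 4 (λ a b s T → b :- s :+ T :+ a := a :- s :+ T :+ b)
             refl a b (start p) (total (lengthBefore a) xs) ⟩
      a - start p + total (lengthBefore a) xs + b
        ≈⟨ +-congʳ (+-congʳ (lengthBefore-inside s≤a (≤-trans a≤b b≤t))) ⟨
      lengthBefore a p + total (lengthBefore a) xs + b
        ∎)
      where
      constant : total (lengthBefore b) xs ≈ total (lengthBefore a) xs
      constant = sym (total-cong (All.zipWith
        (λ (p#q , u≤v) → lengthBefore-constant u≤v p#q s≤a a≤b b≤t) (p# , ss≤ts)))

    afterStart : ∀ {a b} → start p ≤ a → a ≤ b → Bound a b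
    afterStart {a} {b} s≤a a≤b with ≤-total b (stop p) | ≤-total a (stop p)
    ... | inj₁ b≤t | _        = middle s≤a a≤b b≤t
    ... | inj₂ t≤b | inj₁ a≤t = glue (middle s≤a a≤t ≤-refl) (right ≤-refl t≤b)
    ... | inj₂ t≤b | inj₂ t≤a = right t≤a a≤b

    whole : ∀ {a b} → a ≤ b → Bound a b
    whole {a} {b} a≤b with ≤-total b (start p) | ≤-total a (start p)
    ... | inj₁ b≤s | _        = left a≤b b≤s
    ... | inj₂ s≤b | inj₁ a≤s = glue (left a≤s ≤-refl) (afterStart ≤-refl s≤b)
    ... | inj₂ s≤b | inj₂ s≤a = afterStart s≤a a≤b

-- Work forced before a given time against machine capacity

module Capacity (em : ExcludedMiddle 0ℓ) (ℝ : CompleteOrderedField)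
                (m : ℕ) (ε : CompleteOrderedField.Carrier ℝ) where

  open CompleteOrderedField ℝ hiding (zero)
  open Scheduling em ℝ m ε
  open OrderedField ℝ
  open ListTotals ℝ
  open Min totalOrder using (_⊓_; x⊓y≤x; x⊓y≤y)
  open Sum semiring using (sum-replicate)
  open PartialOrderReasoning poset hiding (start; stop)

  -- The least amount of work that a job of length p with deadline (1 + ε) p
  -- must receive before time D.
  workBefore : Carrier → Carrier → Carrier
  workBefore D p = p ⊓ (D - ε * p)

  -- With `h = id` this is `volume`; with `h = workBefore D` it is the work forced before `D`.
  score : ∀ {n} → (Carrier → Carrier) → Vec Job n → Subset n → Carrier
  score h J S = sum (λ i → if lookup S i then h (proc (lookup J i)) else 0#)

  module _ {n} {J : Vec Job n} {S : Subset n} {σ : Schedule n}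
           (release≥0 : ∀ i → 0# ≤ release (lookup J i))
           (tight : ∀ i → deadline (lookup J i) ≤ (1# + ε) * proc (lookup J i))
           (feasible : IsFeasible J S σ) where
    open IsFeasible feasible
    open Packing ℝ {Piece n} start stop

    private
      proper : All Proper σ
      proper = All.universal (λ p → <⇒≤ {start p} {stop p} (start<stop p)) σ

      starts≥0 : All (λ p → 0# ≤ start p) σ
      starts≥0 = All.map (λ {p} (r≤s , _) → ≤-trans (release≥0 (job p)) r≤s) inWindow

    -- Packing on [0, D]: no piece starts before 0, because every release date is nonnegative.
    machine-capacity : ∀ {D} → 0# ≤ D → ∀ k →
      total (lengthBefore D) (filter (λ p → machine p Fin.≟ k) σ) ≤ D
    machine-capacity {D} 0≤D k = begin
      total (lengthBefore D) L      ≈⟨ +-identityʳ _ ⟨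
      total (lengthBefore D) L + 0# ≤⟨ packing (All.filter⁺ onMachine proper) disjoint 0≤D ⟩
      total (lengthBefore 0#) L + D ≈⟨ +-congʳ (total-0 (All.filter⁺ onMachine nothingBefore0)) ⟩
      0# + D                        ≈⟨ +-identityˡ D ⟩
      D                             ∎
      where
      onMachine = λ (p : Piece n) → machine p Fin.≟ k
      L = filter onMachine σ

      nothingBefore0 : All (λ p → lengthBefore 0# p ≈ 0#) σ
      nothingBefore0 = All.zipWith (λ {p} (s≤t , 0≤s) → lengthBefore-≤start {p = p} s≤t 0≤s)
        (proper , starts≥0)

      disjoint : AllPairs Disjoint L
      disjoint = allPairs-restrict (λ p≡k q≡k d → d (inj₁ (≡.trans p≡k (≡.sym q≡k))))
        (All.all-filter onMachine σ) (AllPairs.filter⁺ onMachine noConflict)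

    job-work : ∀ D i → i ∈ S →
      workBefore D (proc (lookup J i)) ≤ total (lengthBefore D) (filter (λ p → job p Fin.≟ i) σ)
    job-work D i i∈S = bound (≤-total d D)
      where
      p d : Carrier
      p = proc (lookup J i)
      d = deadline (lookup J i)

      ofJob = λ (q : Piece n) → job q Fin.≟ i
      L = filter ofJob σ
      properL = All.filter⁺ ofJob proper

      processedBefore : ∀ {t} → d ≤ t → total (lengthBefore t) L ≈ p
      processedBefore d≤t = trans
        (total-cong (All.zipWith
          (λ {q} (s≤t , e≤d) → lengthBefore-≥stop {p = q} s≤t (≤-trans e≤d d≤t)) (properL , stops)))
        (completed i i∈S)
        where
        stops : All (λ q → stop q ≤ d) L
        stops = All.zipWith (λ { (≡.refl , _ , e≤d) → e≤d })
          (All.all-filter ofJob σ , All.filter⁺ ofJob inWindow)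

      -- A job never runs on two machines at once, so packing also applies to the pieces of one job
      -- across all machines.
      disjoint : AllPairs Disjoint L
      disjoint = allPairs-restrict (λ p≡i q≡i apart → apart (inj₂ (≡.trans p≡i (≡.sym q≡i))))
        (All.all-filter ofJob σ) (AllPairs.filter⁺ ofJob noConflict)

      bound : d ≤ D ⊎ D ≤ d → workBefore D p ≤ total (lengthBefore D) L
      bound (inj₁ d≤D) = ≤-trans (x⊓y≤x _ _) (≤-reflexive (sym (processedBefore d≤D)))
      -- At most d - D ≤ (1 + ε) p - D of the work is left for [D, d].
      bound (inj₂ D≤d) = ≤-trans (x⊓y≤y _ _) (shift-≤ (+-mono-≤ (packing properL disjoint D≤d) (tight i))
        (trans (+-congˡ (+-congʳ (+-congʳ (processedBefore ≤-refl))))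
          (solve 5 (λ T D d p e → T :+ (p :+ D :+ d) := D :- e :* p :+ (T :+ d :+ (con (+ 1) :+ e) :* p))
            refl (total (lengthBefore D) L) D d p ε)))

    -- The processing done before `D` is counted twice: grouped by job it is at least the forced
    -- work, grouped by machine it is at most `D` each.
    capacity : ∀ {D} → 0# ≤ D → score (workBefore D) J S ≤ fromℕ m * D
    capacity {D} 0≤D = begin
      score (workBefore D) J S
        ≤⟨ sum-mono-≤ perJob ⟩
      sum (λ i → total (lengthBefore D) (filter (λ p → job p Fin.≟ i) σ))
        ≈⟨ sum-total-filter job (lengthBefore D) σ ⟩
      total (lengthBefore D) σ
        ≈⟨ sum-total-filter machine (lengthBefore D) σ ⟨
      sum (λ k → total (lengthBefore D) (filter (λ p → machine p Fin.≟ k) σ))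
        ≤⟨ sum-mono-≤ {m} (machine-capacity 0≤D) ⟩
      sum {m} (λ _ → D)
        ≈⟨ sum-replicate m ⟩
      m · D
        ≈⟨ ·≈fromℕ* m D ⟩
      fromℕ m * D
        ∎
      where
      perJob : ∀ i → (if lookup S i then workBefore D (proc (lookup J i)) else 0#)
                   ≤ total (lengthBefore D) (filter (λ p → job p Fin.≟ i) σ)
      perJob i with lookup S i in eq
      ... | true  = job-work D i (lookup⇒[]= i S eq)
      ... | false = total-nonNeg
        (All.filter⁺ (λ p → job p Fin.≟ i) (All.map (λ {p} → lengthBefore-nonNeg {p = p}) proper))

-- A round robin schedule for equal jobs, and lower bounds on the optimum

-- Adding n - c undoes the shift by `c` modulo `n`, and `i`, `j` are already reduced.
+-%-cancelʳ : ∀ {i j} c {n} .{{_ : NonZero n}} → i ℕ.< n → j ℕ.< n → c ℕ.≤ n →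
              (i ℕ.+ c) % n ≡ (j ℕ.+ c) % n → i ≡ j
+-%-cancelʳ {i} {j} c {n} i<n j<n c≤n eq = begin
  i                                           ≡⟨ undo i i<n ⟨
  ((i ℕ.+ c) % n ℕ.+ (n ℕ.∸ c) % n) % n       ≡⟨ ≡.cong (λ x → (x ℕ.+ (n ℕ.∸ c) % n) % n) eq ⟩
  ((j ℕ.+ c) % n ℕ.+ (n ℕ.∸ c) % n) % n       ≡⟨ undo j j<n ⟩
  j                                           ∎
  where
  open ≡.≡-Reasoning
  undo : ∀ x → x ℕ.< n → ((x ℕ.+ c) % n ℕ.+ (n ℕ.∸ c) % n) % n ≡ x
  undo x x<n = begin
    ((x ℕ.+ c) % n ℕ.+ (n ℕ.∸ c) % n) % n ≡⟨ %-distribˡ-+ (x ℕ.+ c) (n ℕ.∸ c) n ⟨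
    (x ℕ.+ c ℕ.+ (n ℕ.∸ c)) % n           ≡⟨ ≡.cong (_% n) (ℕ.+-assoc x c (n ℕ.∸ c)) ⟩
    (x ℕ.+ (c ℕ.+ (n ℕ.∸ c))) % n         ≡⟨ ≡.cong (λ y → (x ℕ.+ y) % n) (ℕ.m+[n∸m]≡n c≤n) ⟩
    (x ℕ.+ n) % n                         ≡⟨ [m+n]%n≡m%n x n ⟩
    x % n                                 ≡⟨ m<n⇒m%n≡m x<n ⟩
    x                                     ∎

module RoundRobin (em : ExcludedMiddle 0ℓ) (ℝ : CompleteOrderedField)
                  (m : ℕ) (ε : CompleteOrderedField.Carrier ℝ) where

  open CompleteOrderedField ℝ hiding (zero)
  open Scheduling em ℝ m ε
  open OrderedField ℝ
  open ListTotals ℝ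
  open Capacity em ℝ m ε using (score)
  open Max totalOrder using (x≤x⊔y; x≤y⊔x)
  open Sum semiring using (sum-cong-≋; sum-replicate)
  open PartialOrderReasoning poset hiding (start; stop)

  total-++ : ∀ {A : Set} (f : A → Carrier) xs ys → total f (xs List.++ ys) ≈ total f xs + total f ys
  total-++ f []       ys = sym (+-identityˡ _)
  total-++ f (x ∷ xs) ys = trans (+-congˡ (total-++ f xs ys)) (sym (+-assoc _ _ _))

  total-filter-concat : ∀ {A : Set} {P : Pred A 0ℓ} (P? : Decidable P) f {k} (g : Fin k → List A) →
    total f (filter P? (List.concat (List.tabulate g))) ≈ sum (λ i → total f (filter P? (g i)))
  total-filter-concat P? f {zero}  g = refl
  total-filter-concat P? f {suc k} g = begin-equality
    total f (filter P? (g zero List.++ List.concat (List.tabulate (g ∘ suc))))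
      ≡⟨ ≡.cong (total f) (List.filter-++ P? (g zero) _) ⟩
    total f (filter P? (g zero) List.++ filter P? (List.concat (List.tabulate (g ∘ suc))))
      ≈⟨ total-++ f (filter P? (g zero)) _ ⟩
    total f (filter P? (g zero)) + total f (filter P? (List.concat (List.tabulate (g ∘ suc))))
      ≈⟨ +-congˡ (total-filter-concat P? f (g ∘ suc)) ⟩
    total f (filter P? (g zero)) + sum (λ i → total f (filter P? (g (suc i))))
      ∎

  total-tabulate : ∀ {A : Set} (f : A → Carrier) {k} (g : Fin k → A) →
    total f (List.tabulate g) ≡ sum (f ∘ g)
  total-tabulate f {zero}  g = ≡.refl
  total-tabulate f {suc k} g = ≡.cong₂ _+_ ≡.refl (total-tabulate f (g ∘ suc))

  -- Histories keep the newest job at the head, so these are the `k` jobs submitted last.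
  firstJobs : ∀ k n → Subset (k ℕ.+ n)
  firstJobs k n = Vec.replicate k inside Vec.++ Vec.replicate n outside

  ∈-firstJobs : ∀ {k n} i → i ∈ firstJobs k n → ∃ λ i′ → i′ ↑ˡ n ≡ i
  ∈-firstJobs {k} {n} i i∈ with Fin.splitAt k i in eq
  ... | inj₁ i′ = i′ , Fin.splitAt⁻¹-↑ˡ eq
  ... | inj₂ i′ = contradiction (≡.trans (≡.sym lookup-outside) ([]=⇒lookup i∈)) λ ()
    where
    lookup-outside : lookup (firstJobs k n) i ≡ outside
    lookup-outside = ≡.trans (≡.cong (lookup (firstJobs k n)) (≡.sym (Fin.splitAt⁻¹-↑ʳ eq)))
      (≡.trans (lookup-++ʳ (Vec.replicate k inside) _ i′) (lookup-replicate i′ outside))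

  firstJobs-∈ : ∀ {k} n i → i ↑ˡ n ∈ firstJobs k n
  firstJobs-∈ {k} n i = lookup⇒[]= (i ↑ˡ n) (firstJobs k n)
    (≡.trans (lookup-++ˡ (Vec.replicate k inside) (Vec.replicate n outside) i) (lookup-replicate i inside))

  copies : ∀ k → Job → ∀ {n} → Vec Job n → Vec Job (k ℕ.+ n)
  copies k j J = Vec.replicate k j Vec.++ J

  lookup-copies : ∀ k j {n} (J : Vec Job n) i → lookup (copies k j J) (i ↑ˡ n) ≡ j
  lookup-copies k j J i = ≡.trans (lookup-++ˡ (Vec.replicate k j) J i) (lookup-replicate i j)

  -- Time is cut into k slots of length ℓ = p / m.  In slot (i + q) mod k
  -- machine q works on copy i, so each copy is in m distinct slots.
  copies-feasible : ∀ k .{{_ : NonZero k}} j {n} (J : Vec Job n) {ℓ} → m ℕ.≤ k → 0# < ℓ →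
    fromℕ m * ℓ ≈ proc j → release j ≤ 0# → fromℕ k * ℓ ≤ deadline j →
    Feasible (copies k j J) (firstJobs k n)
  copies-feasible k j {n} J {ℓ} m≤k 0<ℓ mℓ≈p r≤0 kℓ≤d = σ , record
    { onlyS      = All.concat⁺ (All.tabulate⁺ λ i → All.tabulate⁺ λ q → firstJobs-∈ n i)
    ; inWindow   = All.concat⁺ (All.tabulate⁺ λ i → All.tabulate⁺ λ q → window i q)
    ; noConflict = AllPairs.concat⁺
        -- Pieces of one copy are on different machines, hence in different slots. Pieces of
        -- different copies can conflict only on a common machine, where the slots differ again.
        (All.tabulate⁺ λ i → AllPairs.tabulate⁺ λ q≢q′ _ → separate (slot-injectiveʳ i q≢q′))
        (AllPairs.tabulate⁺ λ i≢i′ → All.tabulate⁺ λ q → All.tabulate⁺ λ q′ →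
          λ { (inj₁ ≡.refl) → separate (slot-injectiveˡ q i≢i′)
            ; (inj₂ i≡i′)   → contradiction (Fin.↑ˡ-injective n _ _ i≡i′) i≢i′ })
    ; completed  = λ i i∈ → let i′ , eq = ∈-firstJobs {k} i i∈ in
        ≡.subst (λ i → processed σ i ≈ proc (lookup (copies k j J) i)) eq (complete-copy i′)
    }
    where
    slot : Fin k → Fin m → ℕ
    slot i q = (toℕ i ℕ.+ toℕ q) % k

    toℕ<k : ∀ (q : Fin m) → toℕ q ℕ.< k
    toℕ<k q = ℕ.<-≤-trans (Fin.toℕ<n q) m≤k

    slot-injectiveˡ : ∀ {i i′} q → i ≢ i′ → slot i q ≢ slot i′ q
    slot-injectiveˡ {i} {i′} q i≢i′ eq = i≢i′ (Fin.toℕ-injective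
      (+-%-cancelʳ (toℕ q) (Fin.toℕ<n i) (Fin.toℕ<n i′) (ℕ.<⇒≤ (toℕ<k q)) eq))

    slot-injectiveʳ : ∀ {q q′} i → q ≢ q′ → slot i q ≢ slot i q′
    slot-injectiveʳ {q} {q′} i q≢q′ eq = q≢q′ (Fin.toℕ-injective
      (+-%-cancelʳ (toℕ i) (toℕ<k q) (toℕ<k q′) (ℕ.<⇒≤ (Fin.toℕ<n i))
        (≡.trans (≡.cong (_% k) (ℕ.+-comm (toℕ q) (toℕ i)))
          (≡.trans eq (≡.cong (_% k) (ℕ.+-comm (toℕ i) (toℕ q′)))))))

    piece : Fin k → Fin m → Piece (k ℕ.+ n)
    piece i q = record
      { machine    = q
      ; job        = i ↑ˡ n
      ; start      = fromℕ (slot i q) * ℓ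
      ; stop       = fromℕ (suc (slot i q)) * ℓ
      ; start<stop = shift-< 0<ℓ (solve 2 (λ s ℓ → (con (+ 1) :+ s) :* ℓ :+ con (+ 0) := s :* ℓ :+ ℓ)
                                   refl (fromℕ (slot i q)) ℓ)
      }

    block : Fin k → List (Piece (k ℕ.+ n))
    block i = List.tabulate (piece i)

    σ : Schedule (k ℕ.+ n)
    σ = List.concat (List.tabulate block)

    window : ∀ i q → release (lookup (copies k j J) (i ↑ˡ n)) ≤ fromℕ (slot i q) * ℓ
                   × fromℕ (suc (slot i q)) * ℓ ≤ deadline (lookup (copies k j J) (i ↑ˡ n))
    window i q rewrite lookup-copies k j J i =
      ≤-trans r≤0 (*-nonNeg (fromℕ-nonNeg (slot i q)) (<⇒≤ 0<ℓ)) ,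
      ≤-trans (*-monoʳ-≤ (<⇒≤ 0<ℓ) (fromℕ-mono-≤ (m%n<n (toℕ i ℕ.+ toℕ q) k))) kℓ≤d

    separate : ∀ {s t} → s ≢ t → fromℕ (suc s) * ℓ ≤ fromℕ t * ℓ ⊎ fromℕ (suc t) * ℓ ≤ fromℕ s * ℓ
    separate {s} {t} s≢t with ℕ.<-cmp s t
    ... | tri< s<t _ _ = inj₁ (*-monoʳ-≤ (<⇒≤ 0<ℓ) (fromℕ-mono-≤ s<t))
    ... | tri≈ _ s≡t _ = contradiction s≡t s≢t
    ... | tri> _ _ t<s = inj₂ (*-monoʳ-≤ (<⇒≤ 0<ℓ) (fromℕ-mono-≤ t<s))

    length : Piece (k ℕ.+ n) → Carrier
    length p = stop p - start p

    block-length : ∀ i → total length (block i) ≈ proc j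
    block-length i = begin-equality
      total length (block i)       ≡⟨ total-tabulate length (piece i) ⟩
      sum (length ∘ piece i)       ≈⟨ sum-cong-≋ (λ q → solve 2 (λ s ℓ → (con (+ 1) :+ s) :* ℓ :- s :* ℓ := ℓ)
                                        refl (fromℕ (slot i q)) ℓ) ⟩
      sum {m} (λ _ → ℓ)            ≈⟨ sum-replicate m ⟩
      m · ℓ                        ≈⟨ ·≈fromℕ* m ℓ ⟩
      fromℕ m * ℓ                  ≈⟨ mℓ≈p ⟩
      proc j                       ∎

    -- Block `i` consists of copy `i` alone, so filtering by job keeps this block whole and drops
    -- all others.
    complete-copy : ∀ i → processed σ (i ↑ˡ n) ≈ proc (lookup (copies k j J) (i ↑ˡ n))
    complete-copy i = begin-equality
      processed σ (i ↑ˡ n)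
        ≈⟨ total-filter-concat ofCopy length block ⟩
      sum (λ i′ → total length (filter ofCopy (block i′)))
        ≈⟨ sum-cong-≋ perBlock ⟩
      sum (λ i′ → if does (i Fin.≟ i′) then proc j else 0#)
        ≈⟨ sum-indicator i (proc j) ⟩
      proc j
        ≡⟨ ≡.cong proc (lookup-copies k j J i) ⟨
      proc (lookup (copies k j J) (i ↑ˡ n))
        ∎
      where
      ofCopy = λ (p : Piece (k ℕ.+ n)) → job p Fin.≟ i ↑ˡ n

      perBlock : ∀ i′ → total length (filter ofCopy (block i′)) ≈ (if does (i Fin.≟ i′) then proc j else 0#)
      perBlock i′ with i Fin.≟ i′
      ... | yes ≡.refl = trans
        (reflexive (≡.cong (total length) (List.filter-all ofCopy {block i} (All.tabulate⁺ λ _ → ≡.refl))))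
        (block-length i)
      ... | no i≢i′    = reflexive (≡.cong (total length) (List.filter-none ofCopy {block i′}
        (All.tabulate⁺ λ _ eq → i≢i′ (≡.sym (Fin.↑ˡ-injective n _ _ eq)))))

  score-none : ∀ h {n} (J : Vec Job n) → score h J (Vec.replicate n outside) ≈ 0#
  score-none h []      = refl
  score-none h (_ ∷ J) = trans (+-identityˡ _) (score-none h J)

  score-copies : ∀ h k j {n} (J : Vec Job n) → score h (copies k j J) (firstJobs k n) ≈ k · h (proc j)
  score-copies h zero    j J = score-none h J
  score-copies h (suc k) j J = +-congˡ (score-copies h k j J)

  ≤-maxOverSubsets : ∀ {n} (f : Subset n → Carrier) S → f S ≤ maxOverSubsets f
  ≤-maxOverSubsets f []            = ≤-refl
  ≤-maxOverSubsets f (inside  ∷ S) = ≤-trans (≤-maxOverSubsets (f ∘ (inside ∷_)) S) (x≤x⊔y _ _)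
  ≤-maxOverSubsets f (outside ∷ S) = ≤-trans (≤-maxOverSubsets (f ∘ (outside ∷_)) S) (x≤y⊔x _ _)

  volume≤OPT : ∀ {n} {J : Vec Job n} {S} → Feasible J S → volume J S ≤ OPT J
  volume≤OPT {J = J} {S} feasible = ≤-trans
    (≤-reflexive (reflexive (≡.cong (λ b → if b then volume J S else 0#)
      (≡.sym (dec-true (em {Feasible J S}) feasible)))))
    (≤-maxOverSubsets _ S)

-- The adversary and the inequality it forces

module Adversary (em : ExcludedMiddle 0ℓ) (ℝ : CompleteOrderedField)
                 (m′ : ℕ) (ε : CompleteOrderedField.Carrier ℝ)
                 (0<ε : CompleteOrderedField._<_ ℝ (CompleteOrderedField.0# ℝ) ε) where

  m : ℕ
  m = suc m′

  open CompleteOrderedField ℝ hiding (zero)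
  open Real em ℝ using (_⁻¹; _/_)
  open Scheduling em ℝ m ε
  open OrderedField ℝ
  open RealProperties em ℝ using (≮⇒≥; ⁻¹-inverse; /-pos; y*[x/y]≈x; powers-unbounded)
  open Capacity em ℝ m ε
  open RoundRobin em ℝ m ε
  open Min totalOrder using (⊓-glb)
  open PartialOrderReasoning poset hiding (start; stop)

  tightJob : Carrier → Job
  tightJob p = record { release = 0# ; proc = p ; deadline = (1# + ε) * p }

  record IsTight (j : Job) : Set where
    field
      proc-pos  : 0# < proc j
      release≡0 : release j ≡ 0#
      deadline≡ : deadline j ≡ (1# + ε) * proc j
  open IsTight

  isTight⇒valid : ∀ {n} {J : Vec Job n} → VecAll.All IsTight J → Valid J
  isTight⇒valid tight = record { jobs = VecAll.map validJob tight ; ordered = ordered tight }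
    where
    validJob : ∀ {j} → IsTight j → ValidJob j
    validJob {j} t = record
      { release≥0 = ≤-reflexive (reflexive (≡.sym (release≡0 t)))
      ; proc>0    = proc-pos t
      ; slack     = ≤-reflexive (begin-equality
          (1# + ε) * proc j      ≈⟨ solve 1 (λ x → x := x :- con (+ 0)) refl _ ⟩
          (1# + ε) * proc j - 0# ≡⟨ ≡.cong₂ _-_ (deadline≡ t) (release≡0 t) ⟨
          deadline j - release j ∎)
      }

    ordered : ∀ {n} {J : Vec Job n} → VecAll.All IsTight J → VecAllPairs.AllPairs (λ j i → release i ≤ release j) J
    ordered []       = []
    ordered (t ∷ ts) =
      VecAll.map (λ t′ → ≤-reflexive (reflexive (≡.trans (release≡0 t′) (≡.sym (release≡0 t))))) ts ∷ ordered ts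

  module _ (A : OnlineAlgorithm) (c : Carrier) (competitive : HasStrictCompetitiveRatio A c)
           (k : ℕ) .{{_ : NonZero k}} (m≤k : m ℕ.≤ k) (k≤m[1+ε] : fromℕ k ≤ fromℕ m * (1# + ε))
           (s : Carrier) (0<s : 0# < s) (c≤ks : c ≤ fromℕ k * s) where
    open OnlineAlgorithm A

    g : Carrier
    g = 1# + s

    1≤g : 1# ≤ g
    1≤g = x≤x+y (<⇒≤ 0<s)

    0<g : 0# < g
    0<g = begin-strict 0# <⟨ 0<1 ⟩ 1# ≤⟨ 1≤g ⟩ g ∎

    job-g^ : ℕ → Job
    job-g^ i = tightJob (g ^ i)

    sumOfPowers : (Carrier → Carrier) → ℕ → Carrier
    sumOfPowers h zero    = 0#
    sumOfPowers h (suc i) = h (g ^ i) + sumOfPowers h i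

    sumOfPowers-nonNeg : ∀ i → 0# ≤ sumOfPowers id i
    sumOfPowers-nonNeg zero    = ≤-refl
    sumOfPowers-nonNeg (suc i) = +-nonNeg (<⇒≤ (^-pos i 0<g)) (sumOfPowers-nonNeg i)

    -- The geometric sum with ratio `g`, where g - 1 = s, freed of division and subtraction.
    s*sumOfPowers : ∀ i → s * sumOfPowers id i + 1# ≈ g ^ i
    s*sumOfPowers zero    = solve 1 (λ s → s :* con (+ 0) :+ con (+ 1) := con (+ 1)) refl s
    s*sumOfPowers (suc i) = begin-equality
      s * (g ^ i + sumOfPowers id i) + 1#
        ≈⟨ solve 3 (λ s G V → s :* (G :+ V) :+ con (+ 1) := s :* G :+ (s :* V :+ con (+ 1)))
             refl s (g ^ i) (sumOfPowers id i) ⟩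
      s * g ^ i + (s * sumOfPowers id i + 1#)
        ≈⟨ +-congˡ (s*sumOfPowers i) ⟩
      s * g ^ i + g ^ i
        ≈⟨ solve 2 (λ s G → s :* G :+ G := (con (+ 1) :+ s) :* G) refl s (g ^ i) ⟩
      g * g ^ i
        ∎

    acceptedScore : (Carrier → Carrier) → ∀ {n} → Vec Job n → Carrier
    acceptedScore h J = score h J (accepted J)

    -- Quantifying scores over all h encodes that the accepted jobs are exactly
    -- one of each length g ^ l with l < i.
    record State (i : ℕ) : Set where
      field
        {count} : ℕ
        history : Vec Job count
        tight   : VecAll.All IsTight history
        scores  : ∀ h → acceptedScore h history ≈ sumOfPowers h i

    tightJob-isTight : ∀ i → IsTight (job-g^ i)
    tightJob-isTight i = record { proc-pos = ^-pos i 0<g ; release≡0 = ≡.refl ; deadline≡ = ≡.refl }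

    copies-isTight : ∀ a {j n} {J : Vec Job n} → IsTight j → VecAll.All IsTight J → VecAll.All IsTight (copies a j J)
    copies-isTight zero    t ts = ts
    copies-isTight (suc a) t ts = t ∷ copies-isTight a t ts

    acceptedScore-∷ : ∀ h {n} (J : Vec Job n) j {b} → accept J j ≡ b →
      acceptedScore h (j ∷ J) ≈ (if b then h (proc j) else 0#) + acceptedScore h J
    acceptedScore-∷ h J j ≡.refl = refl

    -- Once a copy is accepted the new state is kept and nothing more is offered. If all copies are
    -- rejected, every score stays as it was in `S`, which is the form used to reach a
    -- contradiction.
    offer : ∀ {i} (S : State i) a → let open State S in
      State (suc i) ⊎ (∀ h → acceptedScore h (copies a (job-g^ i) history) ≈ sumOfPowers h i)
    offer     S zero    = inj₂ (State.scores S)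
    offer {i} S (suc a) with offer S a
    ... | inj₁ S′       = inj₁ S′
    ... | inj₂ rejected = decide (accept J (job-g^ i)) ≡.refl
      where
      open State S
      J = copies a (job-g^ i) history

      decide : ∀ b → accept J (job-g^ i) ≡ b →
        State (suc i) ⊎ (∀ h → acceptedScore h (job-g^ i ∷ J) ≈ sumOfPowers h i)
      decide true  eq = inj₁ record
        { history = job-g^ i ∷ J
        ; tight   = tightJob-isTight i ∷ copies-isTight a (tightJob-isTight i) tight
        ; scores  = λ h → trans (acceptedScore-∷ h J (job-g^ i) eq) (+-congˡ (rejected h))
        }
      decide false eq = inj₂ λ h → trans (acceptedScore-∷ h J (job-g^ i) eq) (trans (+-identityˡ _) (rejected h))

    -- With slots of length `g ^ i / fromℕ m`, the `k` slots end by the deadline because k ≤ m (1 +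
    -- ε).
    copies-job-g^-feasible : ∀ i {n} (J : Vec Job n) → Feasible (copies k (job-g^ i) J) (firstJobs k n)
    copies-job-g^-feasible i J = copies-feasible k (job-g^ i) J m≤k 0<ℓ mℓ≈p ≤-refl (begin
      fromℕ k * ℓ              ≤⟨ *-monoʳ-≤ (<⇒≤ 0<ℓ) k≤m[1+ε] ⟩
      fromℕ m * (1# + ε) * ℓ   ≈⟨ solve 3 (λ m e ℓ → m :* e :* ℓ := e :* (m :* ℓ)) refl (fromℕ m) (1# + ε) ℓ ⟩
      (1# + ε) * (fromℕ m * ℓ) ≈⟨ *-congˡ mℓ≈p ⟩
      (1# + ε) * g ^ i         ∎)
      where
      0<m : 0# < fromℕ m
      0<m = fromℕ-suc-pos m′

      ℓ : Carrier
      ℓ = g ^ i / fromℕ m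

      0<ℓ : 0# < ℓ
      0<ℓ = /-pos (^-pos i 0<g) 0<m

      mℓ≈p : fromℕ m * ℓ ≈ g ^ i
      mℓ≈p = y*[x/y]≈x (g ^ i) (0<x⇒x≉0 0<m)

    -- The optimum is at least k g^i, whereas the accepted volume V satisfies c V ≤ k s V = k (g^i -
    -- 1).
    rejecting-all-impossible : ∀ {i n} {J : Vec Job n} → VecAll.All IsTight J →
      ¬ (∀ h → acceptedScore h (copies k (job-g^ i) J) ≈ sumOfPowers h i)
    rejecting-all-impossible {i} {n} {J} tight rejected = <-irrefl refl (begin-strict
      fromℕ k * g ^ i                       ≈⟨ ·≈fromℕ* k (g ^ i) ⟨
      k · g ^ i                             ≈⟨ score-copies id k (job-g^ i) J ⟨
      volume copiesJ (firstJobs k n)        ≤⟨ volume≤OPT (copies-job-g^-feasible i J) ⟩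
      OPT copiesJ                           ≤⟨ competitive copiesJ (isTight⇒valid (copies-isTight k (tightJob-isTight i) tight)) ⟩
      c * ALG A copiesJ                     ≈⟨ *-congˡ (rejected id) ⟩
      c * sumOfPowers id i                  ≤⟨ *-monoʳ-≤ (sumOfPowers-nonNeg i) c≤ks ⟩
      fromℕ k * s * sumOfPowers id i        ≈⟨ *-assoc _ _ _ ⟩
      fromℕ k * (s * sumOfPowers id i)      <⟨ *-monoˡ-< 0<k (x<x+1 _) ⟩
      fromℕ k * (s * sumOfPowers id i + 1#) ≈⟨ *-congˡ (s*sumOfPowers i) ⟩
      fromℕ k * g ^ i                       ∎)
      where
      copiesJ = copies k (job-g^ i) J
      0<k : 0# < fromℕ k
      0<k = begin-strict 0# <⟨ fromℕ-suc-pos m′ ⟩ fromℕ m ≤⟨ fromℕ-mono-≤ m≤k ⟩ fromℕ k ∎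

    state : ∀ i → State i
    state zero    = record { history = [] ; tight = [] ; scores = λ h → refl }
    state (suc i) with offer (state i) k
    ... | inj₁ S        = S
    ... | inj₂ rejected = contradiction rejected (rejecting-all-impossible {i} (State.tight (state i)))

    module _ (i : ℕ) where
      D : Carrier
      D = (1# + ε) * g ^ i

      0≤1+ε : 0# ≤ 1# + ε
      0≤1+ε = +-nonNeg 0≤1 (<⇒≤ 0<ε)

      -- Here the deadline (1 + ε) p is at most `D`, which is the same as p ≤ D - ε p.
      small-work : ∀ {p} → p ≤ g ^ i → p ≤ workBefore D p
      small-work {p} p≤gⁱ = ⊓-glb ≤-refl (shift-≤ (*-monoˡ-≤ 0≤1+ε p≤gⁱ)
        (solve 3 (λ e p D → (D :- e :* p) :+ (con (+ 1) :+ e) :* p := p :+ D) refl ε p D))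

      -- Here the deadline is at least `D`, so D - ε p is the smaller term of the minimum.
      large-work : ∀ {p} → g ^ i ≤ p → D - ε * p ≤ workBefore D p
      large-work {p} gⁱ≤p = ⊓-glb (shift-≤ (*-monoˡ-≤ 0≤1+ε gⁱ≤p)
        (solve 3 (λ e p D → p :+ D := (D :- e :* p) :+ (con (+ 1) :+ e) :* p) refl ε p D)) ≤-refl

      -- The largest length in the sum is g^(l - 1), so `l` may go up to `suc i`.
      small-works : ∀ l → l ℕ.≤ suc i → sumOfPowers id l ≤ sumOfPowers (workBefore D) l
      small-works zero    _         = ≤-refl
      small-works (suc l) (s≤s l≤i) =
        +-mono-≤ (small-work (^-monoʳ-≤ 1≤g l≤i)) (small-works l (ℕ.m≤n⇒m≤1+n l≤i))

      -- The lengths g ^ 0, …, g ^ (t + i) require work at least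
      -- ((g ^ (i + 1) - 1) + s t D - ε (g ^ (t + i + 1) - g ^ (i + 1))) / s;
      -- this is multiplied by s and freed of subtractions.
      works : ∀ t → g ^ suc i + s * (fromℕ t * D) + ε * g ^ suc i
                  ≤ s * sumOfPowers (workBefore D) (t ℕ.+ suc i) + ε * g ^ (t ℕ.+ suc i) + 1#
      works zero    = begin
        g ^ suc i + s * (0# * D) + ε * g ^ suc i
          ≈⟨ solve 4 (λ G s D E → G :+ s :* (con (+ 0) :* D) :+ E := G :+ E)
               refl (g ^ suc i) s D (ε * g ^ suc i) ⟩
        g ^ suc i + ε * g ^ suc i
          ≈⟨ +-congʳ (s*sumOfPowers (suc i)) ⟨
        s * sumOfPowers id (suc i) + 1# + ε * g ^ suc i
          ≈⟨ solve 3 (λ a b c → a :+ b :+ c := a :+ c :+ b) refl _ _ _ ⟩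
        s * sumOfPowers id (suc i) + ε * g ^ suc i + 1#
          ≤⟨ +-monoˡ-≤ 1# (+-monoˡ-≤ (ε * g ^ suc i)
               (*-monoˡ-≤ (<⇒≤ 0<s) (small-works (suc i) ℕ.≤-refl))) ⟩
        s * sumOfPowers (workBefore D) (suc i) + ε * g ^ suc i + 1#
          ∎
      works (suc t) = shift-≤ (+-mono-≤ (works t) (*-monoˡ-≤ (<⇒≤ 0<s) (large-work gⁱ≤p)))
        (solve 8 (λ s e D G t p W V →
            (s :* (W :+ V) :+ e :* ((con (+ 1) :+ s) :* p) :+ con (+ 1))
              :+ ((G :+ s :* (t :* D) :+ e :* G) :+ s :* (D :- e :* p))
            := (G :+ s :* ((con (+ 1) :+ t) :* D) :+ e :* G)
              :+ ((s :* V :+ e :* p :+ con (+ 1)) :+ s :* W))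
          refl s ε D (g ^ suc i) (fromℕ t) (g ^ (t ℕ.+ suc i)) (workBefore D (g ^ (t ℕ.+ suc i)))
            (sumOfPowers (workBefore D) (t ℕ.+ suc i)))
        where
        gⁱ≤p : g ^ i ≤ g ^ (t ℕ.+ suc i)
        gⁱ≤p = ^-monoʳ-≤ 1≤g (ℕ.≤-trans (ℕ.n≤1+n i) (ℕ.m≤n+m (suc i) t))

      total-work : sumOfPowers (workBefore D) (m′ ℕ.+ suc i) ≤ fromℕ m * D
      -- The state at stage `m′ + suc i` = i + m has accepted the lengths g^0, ..., g^(i + m - 1),
      -- and its plan must respect the capacity up to `D`.
      total-work = begin
        sumOfPowers (workBefore D) (m′ ℕ.+ suc i) ≈⟨ scores (workBefore D) ⟨
        acceptedScore (workBefore D) history      ≤⟨ capacity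
          (λ x → ≤-reflexive (reflexive (≡.sym (release≡0 (VecAll.lookup⁺ tight x)))))
          (λ x → ≤-reflexive (reflexive (deadline≡ (VecAll.lookup⁺ tight x))))
          (plan-feasible history (isTight⇒valid tight)) (*-nonNeg 0≤1+ε (<⇒≤ (^-pos i 0<g))) ⟩
        fromℕ m * D                               ∎
        where open State (state (m′ ℕ.+ suc i))

      -- Adding `works m′` to `s` times `total-work` cancels the unknown work and leaves one summand
      -- s D on the right. Since g - s = 1, the terms (1 + ε) g g^i and s D = s (1 + ε) g^i combine
      -- to (1 + ε) g^i.
      [1+ε-εgᵐ]gⁱ≤1 : (1# + ε - ε * g ^ m) * g ^ i ≤ 1#
      [1+ε-εgᵐ]gⁱ≤1 = shift-≤ (+-mono-≤ (works m′) (*-monoˡ-≤ (<⇒≤ 0<s) total-work))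
        (begin-equality
          _ ≈⟨ solve 6 (λ s e G H t W →
                  con (+ 1)
                  :+ (((con (+ 1) :+ s) :* G :+ s :* (t :* ((con (+ 1) :+ e) :* G))
                       :+ e :* ((con (+ 1) :+ s) :* G)) :+ s :* W)
                  := (con (+ 1) :+ e :- e :* ((con (+ 1) :+ s) :* H)) :* G
                  :+ ((s :* W :+ e :* (H :* ((con (+ 1) :+ s) :* G)) :+ con (+ 1))
                       :+ s :* ((con (+ 1) :+ t) :* ((con (+ 1) :+ e) :* G))))
                refl s ε (g ^ i) (g ^ m′) (fromℕ m′) (sumOfPowers (workBefore D) (m′ ℕ.+ suc i)) ⟩
          _ ≈⟨ +-congˡ (+-congʳ (+-congʳ (+-congˡ (*-congˡ (^-homo-* g m′ (suc i)))))) ⟨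
          _ ∎)

    -- Otherwise a positive constant times g^i would stay below 1 for all i, although the powers of
    -- `g` are unbounded.
    1+ε≤εgᵐ : 1# + ε ≤ ε * g ^ m
    1+ε≤εgᵐ = ≮⇒≥ λ εgᵐ<1+ε →
      let δ    = 1# + ε - ε * g ^ m
          0<δ  = x<y⇒0<y-x εgᵐ<1+ε
          i , δ⁻¹<gⁱ = powers-unbounded 0<s (δ ⁻¹)
      in <⇒≱ (begin-strict
           1#          ≈⟨ ⁻¹-inverse (0<x⇒x≉0 0<δ) ⟨
           δ * δ ⁻¹    <⟨ *-monoˡ-< 0<δ δ⁻¹<gⁱ ⟩
           δ * g ^ i   ∎) ([1+ε-εgᵐ]gⁱ≤1 i)

-- The closed form of the bound, and the theorem

geometric-sum : (ℝ : CompleteOrderedField) → let open CompleteOrderedField ℝ in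
  ∀ b n → sum {n} (λ i → b ^ toℕ i) * (b - 1#) ≈ b ^ n - 1#
geometric-sum ℝ b zero    = solve 1 (λ b → con (+ 0) :* (b :- con (+ 1)) := con (+ 1) :- con (+ 1)) refl b
  where open CompleteOrderedField ℝ
        open OrderedField ℝ
geometric-sum ℝ b (suc n) = begin-equality
  (1# + sum {n} (λ i → b * b ^ toℕ i)) * (b - 1#)
    ≈⟨ *-congʳ (+-congˡ (*-distribˡ-sum {n} b (λ i → b ^ toℕ i))) ⟨
  (1# + b * sum {n} (λ i → b ^ toℕ i)) * (b - 1#)
    ≈⟨ solve 2 (λ b S → (con (+ 1) :+ b :* S) :* (b :- con (+ 1))
                        := b :- con (+ 1) :+ b :* (S :* (b :- con (+ 1))))
         refl b (sum {n} (λ i → b ^ toℕ i)) ⟩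
  b - 1# + b * (sum {n} (λ i → b ^ toℕ i) * (b - 1#))
    ≈⟨ +-congˡ (*-congˡ (geometric-sum ℝ b n)) ⟩
  b - 1# + b * (b ^ n - 1#)
    ≈⟨ solve 2 (λ b B → b :- con (+ 1) :+ b :* (B :- con (+ 1)) := b :* B :- con (+ 1)) refl b (b ^ n) ⟩
  b * b ^ n - 1#
    ∎
  where
  open CompleteOrderedField ℝ
  open OrderedField ℝ
  open Sum semiring using (*-distribˡ-sum)
  open PartialOrderReasoning poset

theorem3 :
    (em : ExcludedMiddle 0ℓ) (ℝ : CompleteOrderedField) →
    let open CompleteOrderedField ℝ
        open Real em ℝ
    in
    (m : ℕ) .{{_ : NonZero m}} (ε : Carrier) → 0# < ε → ε ≤ 1# →
    let open Scheduling em ℝ m ε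
        f = fromℕ ⌊ fromℕ m * (1# + ε) ⌋
        bound = f / (ε * sum {m} (λ i → ((1# + ε) / ε) ^[ toℕ i / m ]))
    in
    (bound ≈ f * (((1# + ε) / ε) ^[ 1 / m ] - 1#))
    × ((A : OnlineAlgorithm) (c : Carrier) → HasStrictCompetitiveRatio A c → bound ≤ c)
theorem3 em ℝ m@(suc m′) ε 0<ε _ = bound≈ , λ A c competitive → ≮⇒≥ λ c<bound →
  let c<k[b-1] : c < fromℕ k * (b - 1#)
      c<k[b-1] = begin-strict
        c                       <⟨ c<bound ⟩
        _                       ≈⟨ bound≈ ⟩
        fromℕ k * (b ^ 1 - 1#)  ≈⟨ *-congˡ (+-congʳ (*-identityʳ b)) ⟩
        fromℕ k * (b - 1#)      ∎
      c/k<b-1 : c / fromℕ k < b - 1#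
      c/k<b-1 = *-cancelˡ-< 0<k (begin-strict
        fromℕ k * (c / fromℕ k) ≈⟨ y*[x/y]≈x c (0<x⇒x≉0 0<k) ⟩
        c                       <⟨ c<k[b-1] ⟩
        fromℕ k * (b - 1#)      ∎)
      -- The interval from c / k to b - 1 has room for an `s` that is also positive, whatever the
      -- sign of `c`, because 1 < b.
      s , 0<s , c/k≤s , s<b-1 = between (x<y⇒0<y-x 1<b) c/k<b-1
      g<b : 1# + s < b
      g<b = shift-< s<b-1 (solve 2 (λ b s → b :+ s := con (+ 1) :+ s :+ (b :- con (+ 1))) refl b s)
      0<g : 0# < 1# + s
      0<g = begin-strict 0# <⟨ 0<1 ⟩ 1# ≤⟨ x≤x+y (<⇒≤ 0<s) ⟩ 1# + s ∎
      c≤ks : c ≤ fromℕ k * s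
      c≤ks = begin
        c                       ≈⟨ y*[x/y]≈x c (0<x⇒x≉0 0<k) ⟨
        fromℕ k * (c / fromℕ k) ≤⟨ *-monoˡ-≤ (<⇒≤ 0<k) c/k≤s ⟩
        fromℕ k * s             ∎
  -- Since `b` is the root, g < b gives ε g^m < 1 + ε, the opposite of what the adversary forces.
  in <⇒≱ (begin-strict
       ε * (1# + s) ^ m  <⟨ *-monoˡ-< 0<ε (^-monoˡ-< m′ 0<g g<b) ⟩
       ε * b ^ m         ≈⟨ εbᵐ≈1+ε ⟩
       1# + ε            ∎)
     (1+ε≤εgᵐ A c competitive k {{k-nonZero}} m≤k (proj₁ k-spec) s 0<s c≤ks)
  where
  open CompleteOrderedField ℝ hiding (zero)
  open Real em ℝ
  open OrderedField ℝ
  open RealProperties em ℝ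
  open PartialOrderReasoning poset hiding (start; stop)
  open Adversary em ℝ m′ ε 0<ε using (1+ε≤εgᵐ)

  β b : Carrier
  β = (1# + ε) / ε
  b = root m β

  k : ℕ
  k = ⌊ fromℕ m * (1# + ε) ⌋

  1≤1+ε : 1# ≤ 1# + ε
  1≤1+ε = x≤x+y (<⇒≤ 0<ε)

  k-spec = ⌊⌋-spec (*-nonNeg (fromℕ-nonNeg m) (≤-trans 0≤1 1≤1+ε))

  m≤k : m ℕ.≤ k
  m≤k = ℕ.≤-pred (fromℕ-cancel-< (begin-strict
    fromℕ m              ≈⟨ *-identityʳ _ ⟨
    fromℕ m * 1#         ≤⟨ *-monoˡ-≤ (fromℕ-nonNeg m) 1≤1+ε ⟩
    fromℕ m * (1# + ε)   <⟨ proj₂ k-spec ⟩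
    fromℕ (suc k)        ∎))

  k-nonZero : NonZero k
  k-nonZero = ℕ.>-nonZero (ℕ.≤-trans (s≤s z≤n) m≤k)

  0<k : 0# < fromℕ k
  0<k = begin-strict 0# <⟨ fromℕ-suc-pos m′ ⟩ fromℕ m ≤⟨ fromℕ-mono-≤ m≤k ⟩ fromℕ k ∎

  0≤β : 0# ≤ β
  0≤β = *-nonNeg (≤-trans 0≤1 1≤1+ε) (<⇒≤ (⁻¹-pos 0<ε))

  εbᵐ≈1+ε : ε * b ^ m ≈ 1# + ε
  εbᵐ≈1+ε = trans (*-congˡ (proj₂ (root-spec m′ 0≤β))) (y*[x/y]≈x (1# + ε) (0<x⇒x≉0 0<ε))

  -- If b ≤ 1, then 1 + ε = ε b^m would be at most ε.
  1<b : 1# < b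
  1<b = ≰⇒> λ b≤1 → <⇒≱ (x<x+1 ε) (begin
    ε + 1#      ≈⟨ +-comm ε 1# ⟩
    1# + ε      ≈⟨ εbᵐ≈1+ε ⟨
    ε * b ^ m   ≤⟨ *-monoˡ-≤ (<⇒≤ 0<ε) (^-monoˡ-≤ m (proj₁ (root-spec m′ 0≤β)) b≤1) ⟩
    ε * 1# ^ m  ≈⟨ *-congˡ (1^n≈1 m) ⟩
    ε * 1#      ≈⟨ *-identityʳ ε ⟩
    ε           ∎)

  Σ : Carrier
  Σ = sum {m} (λ i → b ^ toℕ i)

  -- The geometric sum turns the left side into ε (b^m - 1), and ε b^m = 1 + ε. So b - 1 is the
  -- inverse of the denominator, which makes both forms of the bound agree.
  εΣ[b-1]≈1 : ε * Σ * (b - 1#) ≈ 1#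
  εΣ[b-1]≈1 = begin-equality
    ε * Σ * (b - 1#)    ≈⟨ *-assoc _ _ _ ⟩
    ε * (Σ * (b - 1#))  ≈⟨ *-congˡ (geometric-sum ℝ b m) ⟩
    ε * (b ^ m - 1#)    ≈⟨ solve 2 (λ e B → e :* (B :- con (+ 1)) := e :* B :- e) refl ε (b ^ m) ⟩
    ε * b ^ m - ε       ≈⟨ +-congʳ εbᵐ≈1+ε ⟩
    1# + ε - ε          ≈⟨ solve 1 (λ e → con (+ 1) :+ e :- e := con (+ 1)) refl ε ⟩
    1#                  ∎

  εΣ≉0 : ¬ ε * Σ ≈ 0#
  εΣ≉0 εΣ≈0 = 0≉1 (begin-equality
    0#                ≈⟨ zeroˡ _ ⟨
    0# * (b - 1#)     ≈⟨ *-congʳ εΣ≈0 ⟨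
    ε * Σ * (b - 1#)  ≈⟨ εΣ[b-1]≈1 ⟩
    1#                ∎)

  bound≈ : fromℕ k / (ε * Σ) ≈ fromℕ k * (b ^ 1 - 1#)
  bound≈ = *-congˡ (*-cancelˡ εΣ≉0 (begin-equality
    ε * Σ * (ε * Σ) ⁻¹     ≈⟨ ⁻¹-inverse εΣ≉0 ⟩
    1#                     ≈⟨ εΣ[b-1]≈1 ⟨
    -- The exponent 1 appears because the power 1/m unfolds to `root m β ^ 1`.
    ε * Σ * (b - 1#)       ≈⟨ *-congˡ (+-congʳ (*-identityʳ b)) ⟨
    ε * Σ * (b ^ 1 - 1#)   ∎))
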